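{- Let $n$ and $k$ be positive integers such that $k \equiv 1, 2 \pmod 4$ and $n \geq k + 2$, or $k \equiv 0, 3 \pmod 4$ and $n \geq k + 3$. Let $|A| = k$, and let $f, g \colon A^n \to B$ be functions that are weakly determined by the order of first occurrence. If $\operatorname{deck} f = \operatorname{deck} g$, then $f \equiv g$.
   Context: $A$ and $B$ are sets with at least two elements. $[n] := \{1,\dots,n\}$, $\binom{[n]}{2}$ denotes the set of all $2$-element subsets of $[n]$, and $\Sigma_n$ is the symmetric group on $[n]$. For $\mathbf{a} \in A^n$ and $\sigma \colon [m] \to [n]$, write $\mathbf{a}\sigma := (a_{\sigma(1)},\dots,a_{\sigma(m)}) \in A^m$. Functions $f, g \colon A^n \to B$ are equivalent, $f \equiv g$, if there is $\sigma \in \Sigma_n$ with $f(\mathbf{a}) = g(\mathbf{a}\sigma)$ for all $\mathbf{a} \in A^n$. For $n \geq 2$, $f \colon A^n \to B$ and $I \in \binom{[n]}{2}$, the identification minor $f_I \colon A^{n-1} \to B$ is given by $f_I(\mathbf{a}) = f(\mathbf{a}\delta_I)$, where $\delta_I \colon [n] \to [n-1]$ is defined by $\delta_I(i) = i$ if $i < \max I$, $\delta_I(i) = \min I$ if $i = \max I$, and $\delta_I(i) = i-1$ if $i > \max I$. The deck of $f$, $\operatorname{deck} f$, is the multiset $\{f_I/{\equiv} : I \in \binom{[n]}{2}\}$ of equivalence classes. Let $A^r_{\neq}$ be the set of $r$-tuples over $A$ with pairwise distinct entries and $A^\sharp := \bigcup_{r \geq 1} A^r_{\neq}$. The map $\operatorname{ofo}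 \colon \bigcup_{n \geq 1} A^n \to A^\sharp$ sends a tuple $\mathbf{a}$ to the tuple listing the distinct elements occurring in $\mathbf{a}$ in the order of their first occurrence. A function $f \colon A^n \to B$ is weakly determined by the order of first occurrence if there exist $f^* \colon A^\sharp \to B$ and $\sigma \in \Sigma_n$ such that $f(\mathbf{a}) = f^*(\operatorname{ofo}(\mathbf{a}\sigma))$ for all $\mathbf{a} \in A^n$. -}

module Defs where

open import Level using (Level)
open import Data.Nat as ℕ using (ℕ; zero; suc; pred; NonZero)
import Data.Nat.Properties as ℕ
open import Data.Fin using (Fin; toℕ; _<_; lower; reduce≥)
open import Data.Fin.Properties using (<-cmp; toℕ≤pred[n]; inj⇒≟)
open import Data.Fin.Permutation using (Permutation′; _⟨$⟩ʳ_)
open import Data.List using (List; length; deduplicate)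
open import Data.List.Relation.Unary.Unique.Propositional using (Unique)
open import Data.List.Relation.Unary.Unique.DecPropositional.Properties
  using (deduplicate-!)
open import Data.Product using (∃₂; Σ-syntax; _,_)
open import Data.Vec using (Vec; _∷_; lookup; tabulate; toList)
open import Function using (_∘_)
open import Function.Bundles using (_↔_; Inverse)
open import Function.Properties.Inverse using (↔⇒↣)
open import Relation.Binary.Definitions
  using (DecidableEquality; tri<; tri≈; tri>)
open import Relation.Binary.PropositionalEquality using (_≡_; _≢_)

private
  variable
    a b : Level
    A : Set a
    B : Set b
    m n k : ℕ

AtLeastTwo : Set a → Set a
AtLeastTwo X = ∃₂ λ (x y : X) → x ≢ y

-- Tuples are vectors and [n] is Fin n, so positions are counted from 0.
infixl 8 _·_

_·_ : Vec A n → (Fin m → Fin n) → Vec A m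
as · σ = tabulate (lookup as ∘ σ)

infix 4 _∼_

_∼_ : (f g : Vec A n → B) → Set _
_∼_ {n = n} f g = Σ[ σ ∈ Permutation′ n ] (∀ as → f as ≡ g (as · (σ ⟨$⟩ʳ_)))

-- A 2-element subset of [n] is given by its minimum and its maximum.  The
-- field min<max is irrelevant, so propositional equality of Pairs is
-- equality of the subsets.
record Pair (n : ℕ) : Set where
  constructor pair
  field
    min max  : Fin n
    .min<max : min < max

δ : Pair n → Fin n → Fin (pred n)
δ {suc n} (pair min max min<max) i with <-cmp i max
... | tri< i<max _ _ = lower i (ℕ.<-≤-trans i<max (toℕ≤pred[n] max))
... | tri≈ _ _ _     = lower min (ℕ.<-≤-trans min<max (toℕ≤pred[n] max))
-- reduce≥ {1} subtracts 1 from an element that is at least 1.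
... | tri> _ _ max<i = reduce≥ {1} i (ℕ.≤-trans (ℕ.s≤s ℕ.z≤n) max<i)

minor : (Vec A n → B) → Pair n → Vec A (pred n) → B
minor f I as = f (as · δ I)

-- The deck is the family of ∼-classes of the minors, indexed by Pair n and
-- taken up to reindexing: two such families have the same multiset of classes
-- exactly when a bijection of the index set matches them class by class.
SameDeck : (f g : Vec A n → B) → Set _
SameDeck {n = n} f g =
  Σ[ φ ∈ Pair n ↔ Pair n ] (∀ I → minor f I ∼ minor g (Inverse.to φ I))

-- A^♯.  The length of entries is the r of A^r_≠.  The proofs are irrelevant,
-- so a function on A ♯ depends only on the entries.
record _♯ (A : Set a) : Set a where
  constructor tuple
  field
    entries   : List A
    .nonEmpty : NonZero (length entries)
    .distinct : Unique entries

-- A ↔ Fin k says that A has exactly k elements.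
finite⇒≟ : A ↔ Fin k → DecidableEquality A
finite⇒≟ A↔Fin = inj⇒≟ (↔⇒↣ A↔Fin)

module _ {A : Set a} (_≟_ : DecidableEquality A) where

  deduplicate-nonEmpty : .{{NonZero n}} → (as : Vec A n) →
                         NonZero (length (deduplicate _≟_ (toList as)))
  deduplicate-nonEmpty (_ ∷ _) = _

  -- deduplicate keeps the first occurrence of each element.
  ofo : .{{NonZero n}} → Vec A n → A ♯
  ofo as = tuple (deduplicate _≟_ (toList as))
                 (deduplicate-nonEmpty as)
                 (deduplicate-! _≟_ (toList as))

  WeaklyDeterminedByOfo : .{{NonZero n}} → (Vec A n → B) → Set _
  WeaklyDeterminedByOfo {n = n} {B = B} f =
    Σ[ f* ∈ (A ♯ → B) ] Σ[ σ ∈ Permutation′ n ]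
      (∀ as → f as ≡ f* (ofo (as · (σ ⟨$⟩ʳ_))))

{-# OPTIONS --safe #-}
module Submission where

-- If f = f* ∘ ofo up to a permutation of arguments, then every identification minor
-- of f is f* ∘ ofo in n - 1 variables, so the decks agree iff f*(ofo a) = g*(ofo aσ)
-- for some permutation σ of r + 1 = n - 1 points and all labellings a of the points
-- by letters.  Read f* and g* as functions F, G of words in which repeated letters
-- are absorbed, and call L and M the two orders of the points.  Moving the label of
-- one point c through all letters shows: if G is insensitive to moving letters to
-- the position of c in M, then so is F for the position of c in L.  Starting from the
-- last position this propagates through the last indecomposable block D of σ, so F
-- and G are invariant under permuting the letters of D as soon as two points of D are
-- merged.  This lets D be peeled off: if D has one point or at least three, F and G
-- agree also on the remaining points, while a transposition of two adjacent points
-- exchanges the two orders of the last two letters.  Hence F = G on words with r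
-- letters unless σ consists of an even number of adjacent transpositions and at most
-- one initial fixed point.  For words with fewer distinct letters the last letters
-- may be chosen equal, so this exception is harmless, and for r = k it is excluded by
-- k ≡ 1, 2 (mod 4).

open import Defs
open import Level using (Level; _⊔_)
open import Data.Bool using (Bool; true; false; not)
open import Data.Bool.Properties using (not-involutive)
open import Data.Empty using (⊥-elim)
open import Data.Nat
  using (ℕ; zero; suc; NonZero; _+_; _∸_; _⊓_; _≤_; _<_; _≥_; _%_; _≤′_; ≤′-refl; ≤′-step; z≤n;
    s≤s; _≤?_)
open import Data.Nat.Properties
  using (+-assoc; +-cancelˡ-≡; +-cancelˡ-≤; +-comm; +-identityʳ; +-monoʳ-≤; +-monoˡ-≤; +-suc;
    1+n≰n; <-irrefl; <⇒≤; m+[n∸m]≡n; m<n⇒0<n∸m; m∸n≡0⇒m≤n; m≤m+n; m≤n+m; n≤1+n;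
    suc-injective; ∸-monoʳ-<; anyUpTo?; ≤-antisym; ≤-pred; ≤-refl; ≤-reflexive; ≤-trans; ≤⇒≤′)
open import Data.Fin as Fin using (Fin; toℕ; inject₁; lower)
import Data.Fin.Properties as Fin
open import Data.Fin.Permutation using (_⟨$⟩ʳ_; _⟨$⟩ˡ_; flip; _∘ₚ_; inverseˡ; inverseʳ)
open import Data.List
  using (List; []; _∷_; _++_; _∷ʳ_; [_]; length; map; initLast; _∷ʳ′_; take; drop; filter;
    deduplicate; replicate; tabulate; allFin)
open import Data.List.Properties
  using (++-assoc; ++-identityʳ; ∷-injective; filter-idem; filter-reject; length-++; length-drop;
    length-map; length-replicate; length-tabulate; length-take; map-++; map-cong; map-id;
    map-tabulate; take++drop≡id)
open import Data.List.Membership.Propositional using (_∈_; _∉_)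
open import Data.List.Membership.Propositional.Properties
  using (∈-∃++; ∈-++⁻; ∈-++⁺ˡ; ∈-++⁺ʳ; ∈-map⁺; ∈-deduplicate⁺; ∈-tabulate⁺; ∈-allFin)
open import Data.List.Membership.Propositional.Properties.WithK using (unique∧set⇒bag)
open import Data.List.Relation.Unary.Any using (here; there)
open import Data.List.Relation.Unary.All as All using (All; []; _∷_)
open import Data.List.Relation.Unary.All.Properties using (++⁻ˡ)
open import Data.List.Relation.Unary.AllPairs using ([]; _∷_)
open import Data.List.Relation.Unary.Unique.Propositional using (Unique)
open import Data.List.Relation.Unary.Unique.Propositional.Properties
  using (allFin⁺) renaming (map⁺ to Unique-map⁺)
open import Data.List.Relation.Unary.Unique.DecPropositional.Properties using (deduplicate-!)
open import Data.List.Relation.Binary.BagAndSetEquality using (∼bag⇒↭)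
open import Data.List.Relation.Binary.Permutation.Propositional
  using (_↭_; refl; prep; swap; ↭-refl; ↭-sym; ↭-trans; ↭-reflexive;
    ↭⇒↭ₛ) renaming (trans to trans↭)
open import Data.List.Relation.Binary.Permutation.Propositional.Properties
  using (∈-resp-↭; ↭-length; ↭-empty-inv; ↭-singleton-inv; shift; drop-mid; drop-∷; ++-comm; ++⁺;
    ++⁺ˡ; ++⁺ʳ) renaming (map⁺ to map-↭)
import Data.List.Relation.Binary.Permutation.Setoid.Properties as Permutation
open import Data.Product using (∃; ∃₂; _×_; _,_; proj₁; proj₂)
open import Data.Sum using (_⊎_; inj₁; inj₂)
open import Data.Vec as Vec using (Vec; toList; lookup)
import Data.Vec.Properties as Vec
open import Function using (_∘_; id; Inverse; Injection; mk⇔)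
open import Function.Bundles using (_↔_)
open import Function.Properties.Inverse using (↔⇒↣)
open import Relation.Nullary using (¬_; yes; no; Dec)
open import Relation.Nullary.Decidable using (¬?; map′; _×-dec_)
open import Relation.Binary.Definitions using (DecidableEquality; tri<; tri≈; tri>)
open import Relation.Binary.PropositionalEquality
  using (_≡_; _≢_; refl; sym; trans; cong; cong₂; subst; subst₂; setoid; module ≡-Reasoning)

private
  variable
    a b p : Level
    A : Set a
    B : Set b
    P : Set p

-- Words and labellings

++-split : ∀ {xs us ys vs : List A} → length xs ≡ length us →
           xs ++ ys ≡ us ++ vs → xs ≡ us × ys ≡ vs
++-split {xs = []}     {[]}     eq e = refl , e
++-split {xs = x ∷ xs} {u ∷ us} eq e
  with p , q ← ++-split {xs = xs} {us} (suc-injective eq) (proj₂ (∷-injective e)) =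
  cong₂ _∷_ (proj₁ (∷-injective e)) p , q

splitLength : ∀ n (xs : List A) → n ≤ length xs →
              ∃₂ λ ys zs → xs ≡ ys ++ zs × length ys ≡ n
splitLength zero    xs       _         = [] , xs , refl , refl
splitLength (suc n) (x ∷ xs) (s≤s n≤)
  with ys , zs , refl , refl ← splitLength n xs n≤ = x ∷ ys , zs , refl , refl

map-agree : ∀ {f g : P → A} ps {qs} → map f ps ≡ map g ps →
            (∀ {q} → q ∈ qs → q ∈ ps) → map f qs ≡ map g qs
map-agree {f = f} {g} ps e sub = All-map (λ q∈ → pointwise ps e (sub q∈))
  where
  pointwise : ∀ ps → map f ps ≡ map g ps → ∀ {q} → q ∈ ps → f q ≡ g q
  pointwise (p ∷ ps) e (here refl) = proj₁ (∷-injective e)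
  pointwise (p ∷ ps) e (there q∈)  = pointwise ps (proj₂ (∷-injective e)) q∈
  All-map : ∀ {qs} → (∀ {q} → q ∈ qs → f q ≡ g q) → map f qs ≡ map g qs
  All-map {[]}    _ = refl
  All-map {_ ∷ _} h = cong₂ _∷_ (h (here refl)) (All-map (h ∘ there))

module Labelling (_≟_ : DecidableEquality P) (x₀ : A) where

  label : List P → List A → P → A
  label (p ∷ ps) (u ∷ us) q with q ≟ p
  ... | yes _ = u
  ... | no  _ = label ps us q
  label _ _ _ = x₀

  map-label : ∀ {ps us} → Unique ps → length ps ≡ length us → map (label ps us) ps ≡ us
  map-label {[]}     {[]}     _          _  = refl
  map-label {p ∷ ps} {u ∷ us} (p∉ ∷ uniq) eq with p ≟ p
  ... | no p≢p = ⊥-elim (p≢p refl)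
  ... | yes _  = cong (u ∷_) (trans (skip ps p∉) (map-label uniq (suc-injective eq)))
    where
    skip : ∀ qs → All (p ≢_) qs → map (label (p ∷ ps) (u ∷ us)) qs ≡ map (label ps us) qs
    skip []       []         = refl
    skip (q ∷ qs) (p≢q ∷ p∉) with q ≟ p
    ... | yes refl = ⊥-elim (p≢q refl)
    ... | no _     = cong (label ps us q ∷_) (skip qs p∉)

-- F is a function on the free left regular band (xyx = xy), except that the
-- identity is only imposed in front of at least k letters.
record LeftRegular {A : Set a} {B : Set b} (k : ℕ) (F : List A → B) : Set (a ⊔ b) where
  field absorb : ∀ u {x} v → x ∈ u → k ≤ length v → F (u ++ x ∷ v) ≡ F (u ++ v)

open LeftRegular

-- The fixed suffix `w` supplies the `k` letters that `absorb` asks for, so the middle part alone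
-- satisfies the identity without a length bound.
inContext : ∀ {k} {F : List A → B} → LeftRegular k F → ∀ p w → k ≤ length w →
            LeftRegular 0 (λ z → F (p ++ z ++ w))
inContext {F = F} lr p w k≤ .absorb u {x} v x∈u _ = begin
  F (p ++ (u ++ x ∷ v) ++ w)   ≡⟨ cong F (reassoc (x ∷ v)) ⟩
  F ((p ++ u) ++ x ∷ v ++ w)   ≡⟨ absorb lr (p ++ u) (v ++ w) (∈-++⁺ʳ p x∈u) long ⟩
  F ((p ++ u) ++ v ++ w)       ≡⟨ cong F (reassoc v) ⟨
  F (p ++ (u ++ v) ++ w)       ∎
  where
  open ≡-Reasoning
  reassoc : ∀ v → p ++ (u ++ v) ++ w ≡ (p ++ u) ++ v ++ w
  reassoc v rewrite ++-assoc u v w | ++-assoc p u (v ++ w) = refl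
  long : _ ≤ length (v ++ w)
  long = ≤-trans k≤ (≤-trans (m≤n+m _ (length v)) (≤-reflexive (sym (length-++ v))))

-- Moving letters inside a word

-- If `c` occurs in `v`, the inserted copy makes that later occurrence absorbable. For left regular
-- `f` the identity thus moves a letter forward to position `n` in words of `ℓ` letters.
MovableAt : {A : Set a} {B : Set b} → (List A → B) → ℕ → ℕ → Set _
MovableAt f ℓ n = ∀ u v {c} → length u ≡ n → length (u ++ v) ≡ ℓ → c ∈ u ++ v →
                  f (u ++ c ∷ v) ≡ f (u ++ v)

module _ {f : List A → B} (lr : LeftRegular 0 f) where

  drop-repeated : ∀ u s {x} v → x ∈ u ++ s → f (u ++ s ++ x ∷ v) ≡ f (u ++ s ++ v)
  drop-repeated u s {x} v x∈
    rewrite sym (++-assoc u s (x ∷ v)) | sym (++-assoc u s v) = absorb lr (u ++ s) v x∈ z≤n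

module _ {f : List A → B} (lr : LeftRegular 0 f) {ℓ : ℕ} where

  private
    drop-rep : ∀ u s {x} v → x ∈ u ++ s → f (u ++ s ++ x ∷ v) ≡ f (u ++ s ++ v)
    drop-rep = drop-repeated {f = f} lr

  movable-last : MovableAt f ℓ ℓ
  movable-last u []      eq eq′ c∈ = absorb lr u [] (subst (_ ∈_) (++-identityʳ u) c∈) z≤n
  movable-last u (x ∷ v) {c} refl eq′ c∈ = ⊥-elim (1+n≰n (≤-trans (s≤s (m≤m+n (length u) (length v)))
    (≤-reflexive (trans (sym (+-suc (length u) (length v))) (trans (sym (length-++ u)) eq′)))))

  -- The new case is `c` in `v`. Both `u x c v₁ v₂` and `u x v₁ c v₂` have the value of
  -- `u c x v₁ v₂`: moving `x` to position `n` in the latter gives the first, and moving `c` there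
  -- in the second gives the latter.
  movable-suc : ∀ {n} → MovableAt f ℓ n → MovableAt f ℓ (suc n)
  movable-suc mv u v eq eq′ c∈ with initLast u
  movable-suc mv .(u ∷ʳ x) v {c} eq eq′ c∈ | u ∷ʳ′ x with ∈-++⁻ (u ∷ʳ x) c∈
  ... | inj₁ c∈u = absorb lr (u ∷ʳ x) v c∈u z≤n
  ... | inj₂ c∈v with v₁ , v₂ , refl ← ∈-∃++ c∈v
    rewrite ++-assoc u [ x ] (c ∷ v₁ ++ c ∷ v₂) | ++-assoc u [ x ] (v₁ ++ c ∷ v₂) = begin
      f (u ++ x ∷ c ∷ v₁ ++ c ∷ v₂)
        ≡⟨ drop-rep u (x ∷ c ∷ v₁) v₂ (∈-++⁺ʳ u (there (here refl))) ⟩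
      f (u ++ x ∷ c ∷ v₁ ++ v₂)
        ≡⟨ drop-rep u (x ∷ c ∷ []) (v₁ ++ v₂) (∈-++⁺ʳ u (here refl)) ⟨
      f (u ++ x ∷ c ∷ x ∷ v₁ ++ v₂)
        ≡⟨ mv u (c ∷ x ∷ v₁ ++ v₂) eq₁ (trans (length-shift u v₁) eq′) (∈-++⁺ʳ u (there (here refl))) ⟩
      f (u ++ c ∷ x ∷ v₁ ++ v₂)
        ≡⟨ drop-rep u (c ∷ x ∷ v₁) v₂ (∈-++⁺ʳ u (here refl)) ⟨
      f (u ++ c ∷ x ∷ v₁ ++ c ∷ v₂)
        ≡⟨ mv u (x ∷ v₁ ++ c ∷ v₂) eq₁ eq′ (∈-++⁺ʳ u (there (∈-++⁺ʳ v₁ (here refl)))) ⟩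
      f (u ++ x ∷ v₁ ++ c ∷ v₂) ∎
    where
    open ≡-Reasoning
    eq₁ = suc-injective (trans (sym (trans (length-++ u) (+-comm (length u) 1))) eq)
    length-shift : ∀ u v₁ → length (u ++ c ∷ x ∷ v₁ ++ v₂) ≡ length (u ++ x ∷ v₁ ++ c ∷ v₂)
    length-shift u v₁ = ↭-length (++⁺ˡ u (↭-sym (shift c (x ∷ v₁) v₂)))

  movable-mono : ∀ {n n′} → n ≤ n′ → MovableAt f ℓ n → MovableAt f ℓ n′
  movable-mono n≤ mv = go (≤⇒≤′ n≤)
    where
    go : ∀ {n′} → _ ≤′ n′ → MovableAt f ℓ n′
    go ≤′-refl     = mv
    go (≤′-step n≤) = movable-suc (go n≤)

  -- Moving `y` in front of its left neighbour is an adjacent transposition, available at every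
  -- position from `n` on by `movable-mono`.
  movable⇒↭-invariant : ∀ {n} → MovableAt f ℓ n → ∀ u {v v′} → n ≤ length u →
                        length (u ++ v) ≡ ℓ → v ↭ v′ → f (u ++ v) ≡ f (u ++ v′)
  movable⇒↭-invariant mv u n≤ eq refl = refl
  movable⇒↭-invariant mv u n≤ eq (prep {xs} {ys} x v↭)
    rewrite sym (++-assoc u [ x ] xs) | sym (++-assoc u [ x ] ys) =
    movable⇒↭-invariant mv (u ++ [ x ])
      (≤-trans n≤ (≤-trans (m≤m+n _ 1) (≤-reflexive (sym (length-++ u))))) eq v↭
  movable⇒↭-invariant mv u n≤ eq (swap {xs} {ys} x y v↭) = begin
    f (u ++ x ∷ y ∷ xs)
      ≡⟨ movable-mono n≤ mv u (x ∷ y ∷ xs) refl eq (∈-++⁺ʳ u (there (here refl))) ⟨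
    f (u ++ y ∷ x ∷ y ∷ xs)
      ≡⟨ drop-rep u (y ∷ x ∷ []) xs (∈-++⁺ʳ u (here refl)) ⟩
    f (u ++ y ∷ x ∷ xs)
      ≡⟨ cong f (++-assoc u (y ∷ x ∷ []) xs) ⟨
    f ((u ++ y ∷ x ∷ []) ++ xs)
      ≡⟨ movable⇒↭-invariant mv (u ++ y ∷ x ∷ [])
           (≤-trans n≤ (≤-trans (m≤m+n _ 2) (≤-reflexive (sym (length-++ u)))))
           (trans (cong length (++-assoc u (y ∷ x ∷ []) xs))
                  (trans (↭-length (++⁺ˡ u (swap y x refl))) eq)) v↭ ⟩
    f ((u ++ y ∷ x ∷ []) ++ ys)
      ≡⟨ cong f (++-assoc u (y ∷ x ∷ []) ys) ⟩
    f (u ++ y ∷ x ∷ ys) ∎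
    where open ≡-Reasoning
  movable⇒↭-invariant mv u n≤ eq (trans↭ p q) =
    trans (movable⇒↭-invariant mv u n≤ eq p)
          (movable⇒↭-invariant mv u n≤ (trans (↭-length (++⁺ˡ u (↭-sym p))) eq) q)

-- Labellings that merge two points

Merging : (f g : List A → B) (D D′ : List P) → Set _
Merging {A = A} {P = P} f g D D′ = ∀ (φ : P → A) c R → D ↭ c ∷ R → φ c ∈ map φ R →
                                   f (map φ D) ≡ g (map φ D′)

Merging-sym : ∀ {f g : List A → B} {D D′ : List P} → D ↭ D′ → Merging f g D D′ → Merging g f D′ D
Merging-sym D↭D′ mg φ c R D′↭ φc∈ = sym (mg φ c R (↭-trans D↭D′ D′↭) φc∈)

module _ (_≟_ : DecidableEquality P) {A : Set a} {B : Set b} (x₀ : A) where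
  open Labelling _≟_ x₀
  open ≡-Reasoning

  module _ {f g : List A → B} (lrf : LeftRegular 0 f) {ℓ : ℕ} where

    -- The first letter of the word either precedes the insertion point or is doubled in place, so
    -- inserting it is harmless. It is the reference letter in `movable-transfer`.
    repeated-head : ∀ u v {x} → x ∈ u ++ v → ∃ λ h → h ∈ u ++ v × f (u ++ h ∷ v) ≡ f (u ++ v)
    repeated-head []      (h ∷ v) _ = h , here refl , absorb lrf [ h ] v (here refl) z≤n
    repeated-head (h ∷ u) v       _ = h , here refl , absorb lrf (h ∷ u) v (here refl) z≤n

    -- With c at position i of D and at position j of D′, varying the label of c
    -- moves a repeated letter through position i on one side and position j on
    -- the other.
    movable-transfer : ∀ L₁ {c} L₂ N₁ N₂ → Unique (L₁ ++ c ∷ L₂) → L₁ ++ c ∷ L₂ ↭ N₁ ++ c ∷ N₂ →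
      length (L₁ ++ L₂) ≡ ℓ → Merging f g (L₁ ++ c ∷ L₂) (N₁ ++ c ∷ N₂) →
      MovableAt g ℓ (length N₁) → MovableAt f ℓ (length L₁)
    movable-transfer L₁ {c} L₂ N₁ N₂ uniq D↭D′ lenD mg mv u v {x} lenu lenuv x∈ =
      let h , h∈ , drop-h = repeated-head u v x∈
      -- The value on the `g` side involves only labels of points other than `c`, which do not
      -- depend on the inserted letter. Hence `x` may be replaced by `h`.
      in trans (value x∈) (trans same-value (trans (sym (value h∈)) drop-h))
      where
      N↭L : N₁ ++ N₂ ↭ L₁ ++ L₂
      N↭L = drop-mid N₁ L₁ (↭-sym D↭D′)
      φ : A → P → A
      φ y = label (L₁ ++ c ∷ L₂) (u ++ y ∷ v)
      lenv : length L₂ ≡ length v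
      lenv = +-cancelˡ-≡ (length L₁) _ _ (begin
        length L₁ + length L₂ ≡⟨ length-++ L₁ ⟨
        length (L₁ ++ L₂)     ≡⟨ trans lenD (sym lenuv) ⟩
        length (u ++ v)       ≡⟨ length-++ u ⟩
        length u + length v   ≡⟨ cong (_+ length v) lenu ⟩
        length L₁ + length v  ∎)
      φ-all : ∀ y → map (φ y) (L₁ ++ c ∷ L₂) ≡ u ++ y ∷ v
      φ-all y = map-label uniq (begin
        length (L₁ ++ c ∷ L₂)       ≡⟨ length-++ L₁ ⟩
        length L₁ + suc (length L₂) ≡⟨ cong₂ (λ m n → m + suc n) (sym lenu) lenv ⟩
        length u + suc (length v)   ≡⟨ length-++ u ⟨
        length (u ++ y ∷ v)         ∎)
      φ-split : ∀ y → map (φ y) L₁ ≡ u × φ y c ∷ map (φ y) L₂ ≡ y ∷ v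
      φ-split y = ++-split (trans (length-map (φ y) L₁) (sym lenu))
        (trans (sym (map-++ (φ y) L₁ (c ∷ L₂))) (φ-all y))
      φ-c : ∀ y → φ y c ≡ y
      φ-c y = proj₁ (∷-injective (proj₂ (φ-split y)))
      φ-rest : ∀ y → map (φ y) (L₁ ++ L₂) ≡ u ++ v
      φ-rest y = trans (map-++ (φ y) L₁ L₂)
        (cong₂ _++_ (proj₁ (φ-split y)) (proj₂ (∷-injective (proj₂ (φ-split y)))))
      value : ∀ {y} → y ∈ u ++ v → f (u ++ y ∷ v) ≡ g (map (φ y) (N₁ ++ N₂))
      value {y} y∈ = begin
        f (u ++ y ∷ v)
          ≡⟨ cong f (φ-all y) ⟨
        f (map (φ y) (L₁ ++ c ∷ L₂))
          ≡⟨ mg (φ y) c (L₁ ++ L₂) (shift c L₁ L₂) (subst₂ _∈_ (sym (φ-c y)) (sym (φ-rest y)) y∈) ⟩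
        g (map (φ y) (N₁ ++ c ∷ N₂))
          ≡⟨ cong g (trans (map-++ (φ y) N₁ (c ∷ N₂))
              (cong (λ z → map (φ y) N₁ ++ z ∷ map (φ y) N₂) (φ-c y))) ⟩
        g (map (φ y) N₁ ++ y ∷ map (φ y) N₂)
          ≡⟨ mv (map (φ y) N₁) (map (φ y) N₂) (length-map (φ y) N₁)
               (trans (cong length (sym (map-++ (φ y) N₁ N₂)))
                   (trans (length-map (φ y) (N₁ ++ N₂)) (trans (↭-length N↭L) lenD)))
               (∈-resp-↭ (↭-trans (↭-reflexive (sym (φ-rest y)))
                   (↭-trans (map-↭ (φ y) (↭-sym N↭L)) (↭-reflexive (map-++ (φ y) N₁ N₂)))) y∈) ⟩
        g (map (φ y) N₁ ++ map (φ y) N₂)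
          ≡⟨ cong g (map-++ (φ y) N₁ N₂) ⟨
        g (map (φ y) (N₁ ++ N₂)) ∎
      same-value : ∀ {y z} → g (map (φ y) (N₁ ++ N₂)) ≡ g (map (φ z) (N₁ ++ N₂))
      same-value {y} {z} = cong g (map-agree (L₁ ++ L₂) (trans (φ-rest y) (sym (φ-rest z))) (∈-resp-↭ N↭L))

∈-tail : ∀ {x y : A} {zs} → x ≢ y → y ∈ x ∷ zs → y ∈ zs
∈-tail x≢y (here y≡x) = ⊥-elim (x≢y (sym y≡x))
∈-tail x≢y (there y∈) = y∈

Unique-++⁻ˡ : ∀ xs {ys : List A} → Unique (xs ++ ys) → Unique xs
Unique-++⁻ˡ []       _           = []
Unique-++⁻ˡ (x ∷ xs) (x∉ ∷ uniq) = ++⁻ˡ xs x∉ ∷ Unique-++⁻ˡ xs uniq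

Unique-++⁻ʳ : ∀ xs {ys : List A} → Unique (xs ++ ys) → Unique ys
Unique-++⁻ʳ []       uniq       = uniq
Unique-++⁻ʳ (x ∷ xs) (_ ∷ uniq) = Unique-++⁻ʳ xs uniq

Unique-resp-↭ : ∀ {xs ys : List A} → xs ↭ ys → Unique xs → Unique ys
Unique-resp-↭ {A = A} p = Permutation.Unique-resp-↭ (setoid A) (↭⇒↭ₛ p)

⊆⇒↭++ : ∀ {xs ys : List A} → Unique xs → (∀ {x} → x ∈ xs → x ∈ ys) → ∃ λ zs → ys ↭ xs ++ zs
⊆⇒↭++ {xs = []}     {ys} _ _ = ys , ↭-refl
⊆⇒↭++ {xs = x ∷ xs} (x∉ ∷ uniq) sub with ys₁ , ys₂ , refl ← ∈-∃++ (sub (here refl))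
  with zs , p ← ⊆⇒↭++ {ys = ys₁ ++ ys₂} uniq (λ y∈ → ∈-tail (All.lookup x∉ y∈)
        (∈-resp-↭ (shift x ys₁ ys₂) (sub (there y∈)))) =
  zs , ↭-trans (shift x ys₁ ys₂) (prep x p)

⊆⇒↭ : ∀ {xs ys : List A} → Unique xs → (∀ {x} → x ∈ xs → x ∈ ys) → length xs ≡ length ys → xs ↭ ys
⊆⇒↭ {xs = xs} uniq sub eq with ⊆⇒↭++ uniq sub
... | [] , p = ↭-sym (↭-trans p (↭-reflexive (++-identityʳ xs)))
... | z ∷ zs , p = ⊥-elim (1+n≰n (≤-trans (s≤s (m≤m+n (length xs) (length zs)))
        (≤-reflexive (trans (sym (+-suc (length xs) (length zs)))
          (trans (sym (length-++ xs)) (trans (sym (↭-length p)) (sym eq)))))))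

-- Indecomposable blocks

-- For duplicate-free lists of the same points: the permutation relating them is indecomposable
-- (connected), not a direct sum of shorter ones.
Indecomposable : List P → List P → Set _
Indecomposable D D′ = ∀ D₁ D₂ E₁ E₂ → D ≡ D₁ ++ D₂ → D′ ≡ E₁ ++ E₂ → length D₁ ≡ length E₁ →
                      0 < length D₁ → 0 < length D₂ → ¬ (D₁ ↭ E₁)

Indecomposable-sym : ∀ {D D′ : List P} → D ↭ D′ → Indecomposable D D′ → Indecomposable D′ D
Indecomposable-sym D↭D′ ind E₁ E₂ D₁ D₂ refl refl eq 0<E₁ 0<E₂ E₁↭D₁ =
  ind D₁ D₂ E₁ E₂ refl refl (sym eq) (subst (0 <_) eq 0<E₁) (subst (0 <_) (sym eq₂) 0<E₂) (↭-sym E₁↭D₁)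
  where
  eq₂ : length D₂ ≡ length E₂
  eq₂ = +-cancelˡ-≡ (length D₁) _ _ (trans (sym (length-++ D₁)) (trans (↭-length D↭D′)
          (trans (length-++ E₁) (cong (_+ length E₂) eq))))

module _ (_≟_ : DecidableEquality P) where
  open import Data.List.Membership.DecPropositional _≟_ using (_∈?_)

  ⊈⇒∃ : ∀ (xs ys : List P) → ¬ (∀ {x} → x ∈ xs → x ∈ ys) → ∃ λ x → x ∈ xs × x ∉ ys
  ⊈⇒∃ []       ys ⊈ = ⊥-elim (⊈ λ ())
  ⊈⇒∃ (x ∷ xs) ys ⊈ with x ∈? ys
  ... | no x∉  = x , here refl , x∉
  ... | yes x∈ with y , y∈ , y∉ ← ⊈⇒∃ xs ys (λ sub → ⊈ λ { (here refl) → x∈ ; (there z∈) → sub z∈ }) =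
    y , there y∈ , y∉

  module _ {A : Set a} {B : Set b} (x₀ : A) {ℓ : ℕ} where

    private
      proper-suffix : ∀ {n} (D₁ D₂ : List P) → length D₁ ≡ suc n → length (D₁ ++ D₂) ≡ suc ℓ →
                      n < ℓ → 0 < length D₂
      proper-suffix D₁ (_ ∷ _) _ _ _ = s≤s z≤n
      proper-suffix D₁ []      e₁ e₂ n<ℓ = ⊥-elim (<-irrefl (suc-injective
        (trans (sym e₁) (trans (sym (cong length (++-identityʳ D₁))) e₂))) n<ℓ)

      proper-prefix : ∀ {n c} (X : List P) {Y} → length (X ++ c ∷ Y) ≡ suc n → length X ≤ n
      proper-prefix X {Y} e = ≤-trans (m≤m+n _ (length Y)) (≤-reflexive (suc-injective
        (trans (sym (+-suc (length X) (length Y))) (trans (sym (length-++ X)) e))))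

    -- By indecomposability some point `c` among the first `suc n` of `D` comes later in `D′`.
    -- Movability of `g` reaches its position there, and `movable-transfer` carries it to the
    -- position of `c` in `D`, which is at most `n`.
    movable-pred : ∀ {f g : List A → B} → LeftRegular 0 f → LeftRegular 0 g →
      ∀ {D D′} → Unique D → D ↭ D′ → length D ≡ suc ℓ →
      Indecomposable D D′ → Merging f g D D′ →
      ∀ {n} → n < ℓ → MovableAt g ℓ (suc n) → MovableAt f ℓ n
    movable-pred {f} {g} lrf lrg {D} {D′} uniq D↭D′ lenD ind mg {n} n<ℓ mv
      with D₁ , D₂ , refl , lenD₁ ← splitLength (suc n) D
             (≤-trans n<ℓ (≤-trans (n≤1+n ℓ) (≤-reflexive (sym lenD))))
      with E₁ , E₂ , refl , lenE₁ ← splitLength (suc n) D′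
             (≤-trans n<ℓ (≤-trans (n≤1+n ℓ) (≤-reflexive (sym (trans (↭-length (↭-sym D↭D′)) lenD)))))
      with c , c∈D₁ , c∉E₁ ← ⊈⇒∃ D₁ E₁ (λ sub → ind D₁ D₂ E₁ E₂ refl refl (trans lenD₁ (sym lenE₁))
             (subst (0 <_) (sym lenD₁) (s≤s z≤n)) (proper-suffix D₁ D₂ lenD₁ lenD n<ℓ)
             (⊆⇒↭ (Unique-++⁻ˡ D₁ uniq) sub (trans lenD₁ (sym lenE₁))))
      with X , Y , refl ← ∈-∃++ c∈D₁
      with ∈-++⁻ E₁ (∈-resp-↭ D↭D′ (∈-++⁺ˡ c∈D₁))
    ... | inj₁ c∈E₁ = ⊥-elim (c∉E₁ c∈E₁)
    ... | inj₂ c∈E₂ with X′ , Y′ , refl ← ∈-∃++ c∈E₂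
      rewrite ++-assoc X (c ∷ Y) D₂ | sym (++-assoc E₁ X′ (c ∷ Y′)) =
      movable-mono lrf (proper-prefix X lenD₁)
          (movable-transfer _≟_ x₀ {g = g} lrf X (Y ++ D₂) (E₁ ++ X′) Y′ uniq D↭D′
        (suc-injective (trans (sym (↭-length (shift c X (Y ++ D₂)))) lenD)) mg
        (movable-mono lrg (≤-trans (≤-reflexive (sym lenE₁))
            (≤-trans (m≤m+n _ _) (≤-reflexive (sym (length-++ E₁))))) mv))

    -- Movability descends from position `ℓ` to position `0` and makes both functions symmetric.
    -- Doubling the first letter of `y` gives a merged labelling that links them.
    indecomposable⇒constant : ∀ {f g : List A → B} → LeftRegular 0 f → LeftRegular 0 g →
      ∀ {D D′} → Unique D → D ↭ D′ → length D ≡ suc ℓ → 0 < ℓ →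
      Indecomposable D D′ → Merging f g D D′ →
      ∀ {y y′} → length y ≡ ℓ → y ↭ y′ → f y ≡ g y′
    indecomposable⇒constant lrf lrg {D} _ _ _ (s≤s _) _ _ {[]} () _
    indecomposable⇒constant {f} {g} lrf lrg {D@(c ∷ L)} {D′} uniq D↭D′ lenD 0<ℓ ind mg {h ∷ t} {y′} leny
        y↭y′
      with N₁ , N₂ , refl ← ∈-∃++ (∈-resp-↭ D↭D′ (here refl)) = begin
        f (h ∷ t)                          ≡⟨ absorb lrf [ h ] t (here refl) z≤n ⟨
        f (h ∷ h ∷ t)                      ≡⟨ cong f φ-all ⟨
        f (map φ D)                        ≡⟨ mg φ c L refl (subst₂ _∈_ (sym φ-c) (sym φ-L) (here refl)) ⟩
        g (map φ (N₁ ++ c ∷ N₂))           ≡⟨ cong g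
            (trans (map-++ φ N₁ (c ∷ N₂)) (cong (λ z → map φ N₁ ++ z ∷ map φ N₂) φ-c)) ⟩
        g (map φ N₁ ++ h ∷ map φ N₂)       ≡⟨ movable-mono lrg {ℓ} z≤n mg₀ (map φ N₁) (map φ N₂) refl
            lenN (∈-resp-↭ y↭N (here refl)) ⟩
        g (map φ N₁ ++ map φ N₂)           ≡⟨ movable⇒↭-invariant lrg mg₀ [] z≤n lenN
            (↭-trans (↭-sym y↭N) y↭y′) ⟩
        g y′                               ∎
      where
      open ≡-Reasoning
      open Labelling _≟_ x₀
      φ : P → A
      φ = label (c ∷ L) (h ∷ h ∷ t)
      φ-all : map φ D ≡ h ∷ h ∷ t
      φ-all = map-label uniq (trans lenD (cong suc (sym leny)))
      φ-c : φ c ≡ h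
      φ-c = proj₁ (∷-injective φ-all)
      φ-L : map φ L ≡ h ∷ t
      φ-L = proj₂ (∷-injective φ-all)
      -- The functions alternate in the descent: each is movable at `n` because the other is movable
      -- at `suc n`.
      both : ∀ n k → n + k ≡ ℓ → MovableAt f ℓ n × MovableAt g ℓ n
      both n zero    e rewrite trans (sym (+-comm n 0)) e = movable-last lrf , movable-last lrg
      both n (suc k) e with mf , mg′ ← both (suc n) k (trans (sym (+-suc n k)) e) =
        movable-pred lrf lrg uniq D↭D′ lenD ind mg n<ℓ mg′ ,
        movable-pred lrg lrf (Unique-resp-↭ D↭D′ uniq) (↭-sym D↭D′) (trans (↭-length (↭-sym D↭D′)) lenD)
          (Indecomposable-sym D↭D′ ind) (Merging-sym {f = f} {g} D↭D′ mg) n<ℓ mf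
        where
        n<ℓ : n < ℓ
        n<ℓ = ≤-trans (s≤s (m≤m+n n k)) (≤-reflexive (trans (sym (+-suc n k)) e))
      mg₀ : MovableAt g ℓ 0
      mg₀ = proj₂ (both 0 ℓ refl)
      y↭N : h ∷ t ↭ map φ N₁ ++ map φ N₂
      y↭N = ↭-trans (↭-reflexive (sym φ-L)) (↭-trans (map-↭ φ (drop-mid [] N₁ D↭D′))
          (↭-reflexive (map-++ φ N₁ N₂)))
      lenN : length (map φ N₁ ++ map φ N₂) ≡ ℓ
      lenN = trans (↭-length (↭-sym y↭N)) leny

++-cancelˡ-↭ : ∀ {xs us ys vs : List A} → xs ↭ us → xs ++ ys ↭ us ++ vs → ys ↭ vs
++-cancelˡ-↭ {xs = xs} {us} {ys} {vs} p q = go xs (↭-trans q (++⁺ʳ vs (↭-sym p)))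
  where
  go : ∀ xs → xs ++ ys ↭ xs ++ vs → ys ↭ vs
  go []       q = q
  go (x ∷ xs) q = go xs (drop-∷ q)

record LastBlock {P : Set p} (L M : List P) : Set p where
  field
    {L₀ D M₀ D′}  : List P
    L≡            : L ≡ L₀ ++ D
    M≡            : M ≡ M₀ ++ D′
    L₀↭M₀         : L₀ ↭ M₀
    D↭D′          : D ↭ D′
    D-nonempty    : 0 < length D
    indecomposable : Indecomposable D D′

module _ (_≟_ : DecidableEquality P) where
  open import Data.List.Membership.DecPropositional _≟_ using (_∈?_)

  ↭-dec : ∀ {xs ys : List P} → Unique xs → length xs ≡ length ys → Dec (xs ↭ ys)
  ↭-dec {xs} {ys} uniq eq =
    map′ (λ all → ⊆⇒↭ uniq (All.lookup all) eq) (λ p → All.tabulate (∈-resp-↭ p)) (All.all? (_∈? ys) xs)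

  -- A proper nonempty prefix with the same points on both sides can be cut off without changing the
  -- last block. The recursion is on the bound `n` for the length.
  lastBlock : ∀ n (L M : List P) → length L ≤ n → Unique L → L ↭ M → 0 < length L → LastBlock L M
  lastBlock zero    []      M _  _    _   ()
  lastBlock (suc n) L M L≤ uniq L↭M 0<L with anyUpTo? decomposable? (length L)
    where
    length-take-eq : ∀ m → length (take m L) ≡ length (take m M)
    length-take-eq m = trans (length-take m L) (trans (cong (_⊓_ m) (↭-length L↭M)) (sym (length-take m M)))
    decomposable? : ∀ m → Dec (0 < m × take m L ↭ take m M)
    decomposable? m = (1 ≤? m) ×-dec ↭-dec (Unique-++⁻ˡ (take m L)
        (subst Unique (sym (take++drop≡id m L)) uniq)) (length-take-eq m)
  ... | no indec = record
    { L₀ = [] ; M₀ = [] ; L≡ = refl ; M≡ = refl ; L₀↭M₀ = ↭-refl ; D↭D′ = L↭M ; D-nonempty = 0<L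
    ; indecomposable = λ { D₁ D₂ E₁ E₂ refl refl eq 0<D₁ 0<D₂ D₁↭E₁ → indec
        ( length D₁
        , ≤-trans (≤-trans (≤-reflexive (+-comm 1 _)) (+-monoʳ-≤ (length D₁) 0<D₂))
            (≤-reflexive (sym (length-++ D₁)))
        , 0<D₁
        , subst₂ _↭_ (sym (take-++ D₁)) (trans (sym (take-++ E₁))
            (cong (λ m → take m (E₁ ++ E₂)) (sym eq))) D₁↭E₁) } }
    where
    take-++ : ∀ {A : Set p} (xs : List A) {ys} → take (length xs) (xs ++ ys) ≡ xs
    take-++ []       = refl
    take-++ (x ∷ xs) = cong (x ∷_) (take-++ xs)
  ... | yes (m , m<L , 0<m , L₁↭M₁) = record
    { L≡ = trans (sym (take++drop≡id m L)) (trans (cong (take m L ++_) L≡) (sym (++-assoc (take m L) L₀ D)))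
    ; M≡ = trans (sym (take++drop≡id m M)) (trans (cong (take m M ++_) M≡)
        (sym (++-assoc (take m M) M₀ D′)))
    ; L₀↭M₀ = ↭-trans (++⁺ʳ L₀ L₁↭M₁) (++⁺ˡ (take m M) L₀↭M₀)
    ; D↭D′ = D↭D′ ; D-nonempty = D-nonempty ; indecomposable = indecomposable }
    where
    len : length (drop m L) ≡ length L ∸ m
    len = length-drop m L
    open LastBlock (lastBlock n (drop m L) (drop m M)
      (≤-pred (≤-trans (≤-trans (s≤s (≤-reflexive len)) (∸-monoʳ-< 0<m (<⇒≤ m<L))) L≤))
      (Unique-++⁻ʳ (take m L) (subst Unique (sym (take++drop≡id m L)) uniq))
      (++-cancelˡ-↭ L₁↭M₁ (subst₂ _↭_ (sym (take++drop≡id m L)) (sym (take++drop≡id m M)) L↭M))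
      (≤-trans (m<n⇒0<n∸m m<L) (≤-reflexive (sym len))))

-- One indecomposable last block

module Core {p a b} {P : Set p} (_≟_ : DecidableEquality P) {A : Set a} {B : Set b} (x₀ : A) where
  open Labelling _≟_ x₀
  open ≡-Reasoning

  private
    variable
      F G : Bool → List A → B
      L M L₀ M₀ D D′ : List P
      k r e : ℕ

  -- F false and F true are two versions of one function (G likewise): labelling
  -- with a merged pair relates opposite versions, injective labelling the false
  -- ones.  The versions differ only when the last block is a transposition of two
  -- points; then the true one is the false one precomposed with swapLast.
  record Merges (F G : Bool → List A → B) (L M : List P) (r : ℕ) : Set (a ⊔ b ⊔ p) where
    field
      merge : ∀ j φ c R w → L ↭ c ∷ R → φ c ∈ map φ R → length L + length w ≡ suc r →
              F j (map φ L ++ w) ≡ G (not j) (map φ M ++ w)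
  open Merges

  record Injects (F G : Bool → List A → B) (L M : List P) (r : ℕ) : Set (a ⊔ b ⊔ p) where
    field
      inject : ∀ φ w → length L + length w ≡ r →
               F false (map φ L ++ w) ≡ G false (map φ M ++ w)
  open Injects

  Merges-sym : L ↭ M → Merges F G L M r → Merges G F M L r
  Merges-sym {F = F} {G = G} L↭M mg .merge j φ c R w M↭ φc∈ len =
    sym (trans (mg .merge (not j) φ c R w (↭-trans L↭M M↭) φc∈
        (trans (cong (_+ length w) (↭-length L↭M)) len))
               (cong (λ i → G i _) (not-involutive j)))

  Injects-sym : L ↭ M → Injects F G L M r → Injects G F M L r
  Injects-sym L↭M inj .inject φ w len =
    sym (inj .inject φ w (trans (cong (_+ length w) (↭-length L↭M)) len))

  labelled : Unique L → ∀ v → length v ≡ length L → ∃ λ φ → map φ L ≡ v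
  labelled {L} uniq v eq = label L v , map-label uniq (sym eq)

  -- `L₀` and `D` share no point, so the labels on `D` can be changed freely; `M₀` has the points of
  -- `L₀` and keeps its labels.
  relabelled : Unique (L₀ ++ D) → L₀ ↭ M₀ → ∀ (φ : P → A) Y → length Y ≡ length D →
               ∃ λ χ → map χ L₀ ≡ map φ L₀ × map χ M₀ ≡ map φ M₀ × map χ D ≡ Y
  relabelled {L₀} {D} {M₀} uniq L₀↭M₀ φ Y eq = χ , χ-L₀ , map-agree L₀ χ-L₀ (∈-resp-↭ (↭-sym L₀↭M₀)) ,
      proj₂ χ-split
    where
    χ : P → A
    χ = label (L₀ ++ D) (map φ L₀ ++ Y)
    χ-split : map χ L₀ ≡ map φ L₀ × map χ D ≡ Y
    χ-split = ++-split (trans (length-map χ L₀) (sym (length-map φ L₀)))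
      (trans (sym (map-++ χ L₀ D)) (map-label uniq (begin
        length (L₀ ++ D)               ≡⟨ length-++ L₀ ⟩
        length L₀ + length D           ≡⟨ cong₂ _+_ (sym (length-map φ L₀)) (sym eq) ⟩
        length (map φ L₀) + length Y   ≡⟨ length-++ (map φ L₀) ⟨
        length (map φ L₀ ++ Y)         ∎)))
    χ-L₀ : map χ L₀ ≡ map φ L₀
    χ-L₀ = proj₁ χ-split

  longer : ∀ (u : List A) {T k} → k ≤ length T → k ≤ length (u ++ T)
  longer u k≤ = ≤-trans k≤ (≤-trans (m≤n+m _ (length u)) (≤-reflexive (sym (length-++ u))))

  -- s is map φ L without the second occurrence of the letter shared by c and a
  -- point of R.
  merged-word : ∀ (φ : P → A) {L c R} → L ↭ c ∷ R → φ c ∈ map φ R →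
    ∃ λ s → suc (length s) ≡ length L ×
            (∀ {k} {H : List A → B} → LeftRegular k H → ∀ T → k ≤ length T → H (map φ L ++ T) ≡ H (s ++ T))
  merged-word φ {L} {c} {R} L↭ φc∈ with X , Y , refl ← ∈-∃++ (∈-resp-↭ (↭-sym L↭) (here refl))
    with ∈-++⁻ (map φ X) (∈-resp-↭ (↭-trans (map-↭ φ (↭-sym (drop-mid X [] L↭)))
          (↭-reflexive (map-++ φ X Y))) φc∈)
  ... | inj₁ φc∈X = map φ X ++ map φ Y
    , trans (cong suc (trans (cong length (sym (map-++ φ X Y))) (length-map φ (X ++ Y))))
        (sym (↭-length (shift c X Y)))
    , λ {_} {H} lr T k≤T → begin
        H (map φ (X ++ c ∷ Y) ++ T)
          ≡⟨ cong H (trans (cong (_++ T) (map-++ φ X (c ∷ Y))) (++-assoc (map φ X) (φ c ∷ map φ Y) T)) ⟩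
        H (map φ X ++ φ c ∷ map φ Y ++ T)
          ≡⟨ absorb lr (map φ X) (map φ Y ++ T) φc∈X (longer (map φ Y) k≤T) ⟩
        H (map φ X ++ map φ Y ++ T)
          ≡⟨ cong H (++-assoc (map φ X) (map φ Y) T) ⟨
        H ((map φ X ++ map φ Y) ++ T) ∎
  ... | inj₂ φc∈Y with Y₁ , Y₂ , Y≡ ← ∈-∃++ φc∈Y = map φ X ++ φ c ∷ Y₁ ++ Y₂
    , (begin
        suc (length (map φ X ++ φ c ∷ Y₁ ++ Y₂))    ≡⟨ cong suc
            (↭-length (shift (φ c) (map φ X) (Y₁ ++ Y₂))) ⟩
        suc (suc (length (map φ X ++ Y₁ ++ Y₂)))    ≡⟨ cong suc
            (cong length (cong (φ c ∷_) (++-assoc (map φ X) Y₁ Y₂))) ⟨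
        suc (length (φ c ∷ (map φ X ++ Y₁) ++ Y₂))  ≡⟨ cong suc
            (↭-length (shift (φ c) (map φ X ++ Y₁) Y₂)) ⟨
        suc (length ((map φ X ++ Y₁) ++ φ c ∷ Y₂))  ≡⟨ cong (suc ∘ length)
            (trans (++-assoc (map φ X) Y₁ _) (cong (map φ X ++_) (sym Y≡))) ⟩
        suc (length (map φ X ++ map φ Y))           ≡⟨ cong suc
            (trans (cong length (sym (map-++ φ X Y))) (length-map φ (X ++ Y))) ⟩
        suc (length (X ++ Y))                       ≡⟨ ↭-length (shift c X Y) ⟨
        length (X ++ c ∷ Y)                         ∎)
    , λ {_} {H} lr T k≤T → begin
        H (map φ (X ++ c ∷ Y) ++ T)
          ≡⟨ cong H (trans (cong (_++ T) (trans (map-++ φ X (c ∷ Y))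
              (cong (λ y → map φ X ++ φ c ∷ y) Y≡))) (reassoc (φ c ∷ Y₂) T)) ⟩
        H ((map φ X ++ φ c ∷ Y₁) ++ φ c ∷ Y₂ ++ T)
          ≡⟨ absorb lr (map φ X ++ φ c ∷ Y₁) (Y₂ ++ T) (∈-++⁺ʳ (map φ X) (here refl)) (longer Y₂ k≤T) ⟩
        H ((map φ X ++ φ c ∷ Y₁) ++ Y₂ ++ T)
          ≡⟨ cong H (reassoc Y₂ T) ⟨
        H ((map φ X ++ φ c ∷ Y₁ ++ Y₂) ++ T) ∎
    where
    reassoc : ∀ Z T → (map φ X ++ φ c ∷ Y₁ ++ Z) ++ T ≡ (map φ X ++ φ c ∷ Y₁) ++ Z ++ T
    reassoc Z T = trans (cong (_++ T) (sym (++-assoc (map φ X) (φ c ∷ Y₁) Z)))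
        (++-assoc (map φ X ++ φ c ∷ Y₁) Z T)

  -- A common first point would split off as a block of its own.
  first-letters : D ↭ D′ → Indecomposable D D′ → length D ≡ suc (suc e) →
    ∃ λ p → ∃ λ q → ∃ λ R → ∃₂ λ E E′ →
      D ≡ p ∷ E × D′ ≡ q ∷ E′ × E ↭ q ∷ R × E′ ↭ p ∷ R
  first-letters {D = p ∷ E} {D′ = []}     D↭D′ ind len with () ← ↭-length D↭D′
  first-letters {D = p ∷ E} {D′ = q ∷ E′} D↭D′ ind len with ∈-resp-↭ (↭-sym D↭D′) (here refl)
  ... | here refl = ⊥-elim (ind [ p ] E [ p ] E′ refl refl refl (s≤s z≤n)
                      (≤-trans (s≤s z≤n) (≤-reflexive (sym (suc-injective len)))) refl)
  ... | there q∈E with X , Y , refl ← ∈-∃++ q∈E =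
    p , q , X ++ Y , X ++ q ∷ Y , E′ , refl , refl , shift q X Y ,
    drop-∷ (↭-trans (↭-sym D↭D′) (↭-trans (prep p (shift q X Y)) (swap p q refl)))

  -- If the last points coincided, the other points would form a common proper prefix.
  last-letters : D ↭ D′ → Indecomposable D D′ → length D ≡ suc (suc e) →
    ∃ λ p → ∃ λ q → ∃ λ R → ∃₂ λ E E′ →
      D ≡ E ++ [ p ] × D′ ≡ E′ ++ [ q ] × E ↭ q ∷ R × E′ ↭ p ∷ R
  last-letters {D} {D′} D↭D′ ind len with initLast D | initLast D′
  last-letters D↭D′ ind () | [] | _
  last-letters D↭D′ ind len | E ∷ʳ′ p | [] with () ← trans (sym len) (↭-length D↭D′)
  last-letters D↭D′ ind len | E ∷ʳ′ p | E′ ∷ʳ′ q with ∈-++⁻ E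
      (∈-resp-↭ (↭-sym D↭D′) (∈-++⁺ʳ E′ (here refl)))
  ... | inj₂ (here refl) = ⊥-elim (ind E [ q ] E′ [ q ] refl refl (↭-length E↭E′)
          (≤-trans (s≤s z≤n) (≤-reflexive (sym
              (suc-injective (trans (sym (trans (length-++ E) (+-comm _ 1))) len)))))
          (s≤s z≤n) E↭E′)
    where
    E↭E′ : E ↭ E′
    E↭E′ = subst₂ _↭_ (++-identityʳ E) (++-identityʳ E′) (drop-mid E E′ D↭D′)
  ... | inj₁ q∈E with X , Y , refl ← ∈-∃++ q∈E =
    p , q , X ++ Y , X ++ q ∷ Y , E′ , refl , refl , shift q X Y ,
    drop-∷ (↭-trans (++-comm [ q ] E′) (↭-trans (↭-sym D↭D′) (↭-trans (++-comm (X ++ q ∷ Y) [ p ])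
      (↭-trans (prep p (shift q X Y)) (swap p q refl)))))

  map-++-++ : ∀ (χ : P → A) X Y w → map χ (X ++ Y) ++ w ≡ map χ X ++ map χ Y ++ w
  map-++-++ χ X Y w = trans (cong (_++ w) (map-++ χ X Y)) (++-assoc (map χ X) (map χ Y) w)

  -- In a word of `suc r` letters `bound` leaves at least `k` of them behind `L₀` and `D`, as
  -- `inContext` requires. The block size `suc (suc e)` excludes single points.
  record Setup (F G : Bool → List A → B) (L₀ D M₀ D′ : List P) (k r e : ℕ) : Set (a ⊔ b ⊔ p) where
    field
      lrF            : ∀ j → LeftRegular k (F j)
      lrG            : ∀ j → LeftRegular k (G j)
      uniq           : Unique (L₀ ++ D)
      L₀↭M₀          : L₀ ↭ M₀
      D↭D′           : D ↭ D′
      length-D       : length D ≡ suc (suc e)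
      bound          : length L₀ + (suc (suc e) + k) ≤ suc r
      indecomposable : Indecomposable D D′
      merges         : Merges F G (L₀ ++ D) (M₀ ++ D′) r

    tail-long : ∀ (w : List A) → length L₀ + (suc (suc e) + length w) ≡ suc r → k ≤ length w
    tail-long w len = +-cancelˡ-≤ (suc (suc e)) _ _
        (+-cancelˡ-≤ (length L₀) _ _ (≤-trans bound (≤-reflexive (sym len))))

    relabel : ∀ {D*} → D ↭ D* → ∀ (φ : P → A) Y → length Y ≡ suc (suc e) →
              ∃ λ χ → map χ L₀ ≡ map φ L₀ × map χ M₀ ≡ map φ M₀ × map χ D* ≡ Y
    relabel D↭ φ Y eq = relabelled (Unique-resp-↭ (++⁺ˡ L₀ D↭) uniq) L₀↭M₀ φ Y
        (trans eq (trans (sym length-D) (↭-length D↭)))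

    relabel-D : ∀ (φ : P → A) Y → length Y ≡ suc (suc e) →
                ∃ λ χ → map χ L₀ ≡ map φ L₀ × map χ M₀ ≡ map φ M₀ × map χ D ≡ Y
    relabel-D = relabel refl

    -- With the labels of `L₀` and the tail `w` frozen, `merges` becomes a `Merging` hypothesis on
    -- the block. The words compared have `r` letters, and the `suc e` letters behind `L₀` become
    -- symmetric.
    block-const : ∀ j φ {y y′} w → length y ≡ suc e → y ↭ y′ →
                  length L₀ + (suc (suc e) + length w) ≡ suc r →
                  F j (map φ L₀ ++ y ++ w) ≡ G (not j) (map φ M₀ ++ y′ ++ w)
    block-const j φ w leny y↭y′ len =
      indecomposable⇒constant _≟_ x₀ (inContext (lrF j) (map φ L₀) w (tail-long w len))
        (inContext (lrG (not j)) (map φ M₀) w (tail-long w len))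
        (Unique-++⁻ʳ L₀ uniq) D↭D′ length-D (s≤s z≤n) indecomposable block-merging leny y↭y′
      where
      block-merging : Merging (λ z → F j (map φ L₀ ++ z ++ w)) (λ z → G (not j) (map φ M₀ ++ z ++ w)) D D′
      block-merging ψ c R D↭ ψc∈ with χ , χ-L₀ , χ-M₀ , χ-D ← relabel-D φ (map ψ D)
          (trans (length-map ψ D) length-D) = begin
        F j (map φ L₀ ++ map ψ D ++ w)
          ≡⟨ cong (F j) (trans (map-++-++ χ L₀ D w) (cong₂ (λ u v → u ++ v ++ w) χ-L₀ χ-D)) ⟨
        F j (map χ (L₀ ++ D) ++ w)
          ≡⟨ merges .merge j χ c (L₀ ++ R) w (↭-trans (++⁺ˡ L₀ D↭) (shift c L₀ R)) χc∈ len′ ⟩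
        G (not j) (map χ (M₀ ++ D′) ++ w)
          ≡⟨ cong (G (not j)) (trans (map-++-++ χ M₀ D′ w)
              (cong₂ (λ u v → u ++ v ++ w) χ-M₀ (map-agree D χ-D (∈-resp-↭ (↭-sym D↭D′))))) ⟩
        G (not j) (map φ M₀ ++ map ψ D′ ++ w) ∎
        where
        χ-R : map χ (c ∷ R) ≡ map ψ (c ∷ R)
        χ-R = map-agree D χ-D (∈-resp-↭ (↭-sym D↭))
        χc∈ : χ c ∈ map χ (L₀ ++ R)
        χc∈ = subst (χ c ∈_) (sym (map-++ χ L₀ R)) (∈-++⁺ʳ (map χ L₀)
          (subst₂ _∈_ (sym (proj₁ (∷-injective χ-R))) (sym (proj₂ (∷-injective χ-R))) ψc∈))
        len′ : length (L₀ ++ D) + length w ≡ suc r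
        len′ = trans (cong (_+ length w) (trans (length-++ L₀) (cong (length L₀ +_) length-D)))
                 (trans (+-assoc (length L₀) (suc (suc e)) (length w)) len)

    prefix : ∀ v → length v ≡ length L₀ → ∃ λ φ → map φ L₀ ≡ v
    prefix = labelled (Unique-++⁻ˡ L₀ uniq)

    block-sym : ∀ j v {y y′} w → length v ≡ length L₀ → length y ≡ suc e → y ↭ y′ →
                length L₀ + (suc (suc e) + length w) ≡ suc r →
                F j (v ++ y ++ w) ≡ F j (v ++ y′ ++ w)
    block-sym j v w lenv leny y↭y′ len with φ , refl ← prefix v lenv =
      trans (block-const j φ w leny y↭y′ len)
            (sym (block-const j φ w (trans (↭-length (↭-sym y↭y′)) leny) refl len))

    -- `inject` leads from `F false` to `G false`, and `block-const` leads back to `F true`. The two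
    -- orders of the block end in different points, so on the way the letter behind the symmetric
    -- ones is exchanged with one of them.
    ends-swap : Injects F G (L₀ ++ D) (M₀ ++ D′) r →
      ∀ v x z x′ w → length v ≡ length L₀ → length z ≡ e → length L₀ + (suc (suc e) + length w) ≡ r →
      F false (v ++ x′ ∷ z ++ x ∷ w) ≡ F true (v ++ x ∷ z ++ x′ ∷ w)
    ends-swap inj v x z x′ w lenv lenz len
      with φ , refl ← prefix v lenv
      with p , q , R , E , E′ , D≡ , D′≡ , E↭ , E′↭ ← last-letters D↭D′ indecomposable length-D
      with χ , χ-L₀ , χ-M₀ , χ-D ← relabel {p ∷ q ∷ R}
            (↭-trans (↭-reflexive D≡) (↭-trans (++-comm E [ p ]) (prep p E↭))) φ (x ∷ x′ ∷ z)
                (cong (suc ∘ suc) lenz) = begin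
        F false (map φ L₀ ++ (x′ ∷ z) ++ x ∷ w)
          ≡⟨ block-sym false (map φ L₀) (x ∷ w) (length-map φ L₀) (cong suc lenz) (↭-sym χE↭) (len′ x) ⟩
        F false (map φ L₀ ++ map χ E ++ x ∷ w)
          ≡⟨ cong (F false) (ends χ-L₀ D≡ χ-p) ⟨
        F false (map χ (L₀ ++ D) ++ w)
          ≡⟨ inj .inject χ w (trans (cong (_+ length w)
              (trans (length-++ L₀) (cong (length L₀ +_) length-D)))
                  (trans (+-assoc (length L₀) (suc (suc e)) (length w)) len)) ⟩
        G false (map χ (M₀ ++ D′) ++ w)
          ≡⟨ cong (G false) (ends χ-M₀ D′≡ χ-q) ⟩
        G false (map φ M₀ ++ map χ E′ ++ x′ ∷ w)
          ≡⟨ block-const true φ (x′ ∷ w) (cong suc lenz) (↭-sym χE′↭) (len′ x′) ⟨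
        F true (map φ L₀ ++ (x ∷ z) ++ x′ ∷ w) ∎
      where
      χ-p : χ p ≡ x
      χ-p = proj₁ (∷-injective χ-D)
      χ-q : χ q ≡ x′
      χ-q = proj₁ (∷-injective (proj₂ (∷-injective χ-D)))
      χ-R : map χ R ≡ z
      χ-R = proj₂ (∷-injective (proj₂ (∷-injective χ-D)))
      χE↭ : map χ E ↭ x′ ∷ z
      χE↭ = ↭-trans (map-↭ χ E↭) (↭-reflexive (cong₂ _∷_ χ-q χ-R))
      χE′↭ : map χ E′ ↭ x ∷ z
      χE′↭ = ↭-trans (map-↭ χ E′↭) (↭-reflexive (cong₂ _∷_ χ-p χ-R))
      len′ : ∀ x → length L₀ + (suc (suc e) + length (x ∷ w)) ≡ suc r
      len′ _ = trans (cong (length L₀ +_) (+-suc (suc (suc e)) (length w)))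
          (trans (+-suc (length L₀) _) (cong suc len))
      ends : ∀ {X u C E p y} → map χ X ≡ u → C ≡ E ++ [ p ] → χ p ≡ y →
             map χ (X ++ C) ++ w ≡ u ++ map χ E ++ y ∷ w
      ends {X} {E = E} {p = p} refl refl refl = trans (map-++-++ χ X (E ++ [ p ]) w)
          (cong (map χ X ++_) (map-++-++ χ E [ p ] w))

    ends-swap′ : Injects F G (L₀ ++ D) (M₀ ++ D′) r →
      ∀ j v x z x′ w → length v ≡ length L₀ → length z ≡ e → length L₀ + (suc (suc e) + length w) ≡ r →
      F j (v ++ x′ ∷ z ++ x ∷ w) ≡ F (not j) (v ++ x ∷ z ++ x′ ∷ w)
    ends-swap′ inj false v x z x′ w lenv lenz len = ends-swap inj v x z x′ w lenv lenz len
    ends-swap′ inj true  v x z x′ w lenv lenz len = sym (ends-swap inj v x′ z x w lenv lenz len)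

    -- A repeated label in `L₀` can be deleted, and `x` then fills the vacant place in the prefix.
    -- Thus the symmetric letters begin one place later.
    merged-block-sym : ∀ j (φ : P → A) c R x {y y′} w → L₀ ↭ c ∷ R → φ c ∈ map φ R →
      length y ≡ suc e → y ↭ y′ → length L₀ + (suc (suc e) + length w) ≡ suc r →
      F j (map φ L₀ ++ x ∷ y ++ w) ≡ F j (map φ L₀ ++ x ∷ y′ ++ w)
    merged-block-sym j φ c R x {y} {y′} w L₀↭ φc∈ leny y↭y′ len
      with s , lens , delete ← merged-word φ L₀↭ φc∈ = begin
        F j (map φ L₀ ++ x ∷ y ++ w)  ≡⟨ shorten y ⟩
        F j ((s ++ [ x ]) ++ y ++ w)  ≡⟨ block-sym j (s ++ [ x ]) w lensx leny y↭y′ len ⟩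
        F j ((s ++ [ x ]) ++ y′ ++ w) ≡⟨ shorten y′ ⟨
        F j (map φ L₀ ++ x ∷ y′ ++ w) ∎
      where
      lensx : length (s ++ [ x ]) ≡ length L₀
      lensx = trans (trans (length-++ s) (+-comm (length s) 1)) lens
      shorten : ∀ y → F j (map φ L₀ ++ x ∷ y ++ w) ≡ F j ((s ++ [ x ]) ++ y ++ w)
      shorten y = trans (delete (lrF j) (x ∷ y ++ w) (longer (x ∷ y) (tail-long w len)))
                        (cong (F j) (sym (++-assoc s [ x ] (y ++ w))))

  open Setup

  Setup-sym : Setup F G L₀ D M₀ D′ k r e → Setup G F M₀ D′ L₀ D k r e
  Setup-sym s = record
    { lrF = lrG s ; lrG = lrF s
    ; uniq = Unique-resp-↭ (++⁺ (L₀↭M₀ s) (D↭D′ s)) (uniq s)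
    ; L₀↭M₀ = ↭-sym (L₀↭M₀ s) ; D↭D′ = ↭-sym (D↭D′ s)
    ; length-D = trans (↭-length (↭-sym (D↭D′ s))) (length-D s)
    ; bound = subst (λ n → n + _ ≤ _) (↭-length (L₀↭M₀ s)) (bound s)
    ; indecomposable = Indecomposable-sym (D↭D′ s) (indecomposable s)
    ; merges = Merges-sym (++⁺ (L₀↭M₀ s) (D↭D′ s)) (merges s)
    }

  -- The coincidence lies among the labels of `L₀`, so the block can be labelled at will. Its two
  -- orders begin with different points, labelled `x` and `y`, and the letters after the first are
  -- symmetric by `merged-block-sym`.
  merged-letters-swap : Setup F G L₀ D M₀ D′ k r e →
    ∀ j (φ : P → A) c R x y W → L₀ ↭ c ∷ R → φ c ∈ map φ R → length L₀ + suc (length W) ≡ r →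
    F j (map φ L₀ ++ x ∷ y ∷ W) ≡ G (not j) (map φ M₀ ++ y ∷ x ∷ W)
  merged-letters-swap {F} {G} {L₀} {D} {M₀} {D′} {k} {r} {e} s j φ c R x y W L₀↭ φc∈ len
    with splitLength e W (+-cancelˡ-≤ 2 _ _ (+-cancelˡ-≤ (length L₀) _ _
        (≤-trans (≤-trans (+-monoʳ-≤ (length L₀) (m≤m+n (suc (suc e)) k)) (bound s))
          (≤-reflexive (sym (trans (+-suc (length L₀) _) (cong suc len)))))))
  ... | W₁ , W₂ , refl , lenW₁
    with p , q , S , E , E′ , refl , refl , E↭ , E′↭ ← first-letters (D↭D′ s) (indecomposable s)
          (length-D s)
    with χ , χ-L₀ , χ-M₀ , χ-pq ← relabel s {p ∷ q ∷ S} (prep p E↭) φ (x ∷ y ∷ W₁)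
          (cong (suc ∘ suc) lenW₁) = begin
      F j (map φ L₀ ++ x ∷ (y ∷ W₁) ++ W₂)
        ≡⟨ merged-block-sym s j φ c R x W₂ L₀↭ φc∈ (cong suc lenW₁) (↭-sym χE↭) len₁ ⟩
      F j (map φ L₀ ++ x ∷ map χ E ++ W₂)
        ≡⟨ cong (F j) (trans (map-++-++ χ L₀ (p ∷ E) W₂)
            (cong₂ (λ u z → u ++ z ∷ map χ E ++ W₂) χ-L₀ χ-p)) ⟨
      F j (map χ (L₀ ++ p ∷ E) ++ W₂)
        ≡⟨ merges s .merge j χ c (R ++ p ∷ E) W₂ (++⁺ʳ (p ∷ E) L₀↭) χc∈ len₂ ⟩
      G (not j) (map χ (M₀ ++ q ∷ E′) ++ W₂)
        ≡⟨ cong (G (not j)) (trans (map-++-++ χ M₀ (q ∷ E′) W₂)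
            (cong₂ (λ u z → u ++ z ∷ map χ E′ ++ W₂) χ-M₀ χ-q)) ⟩
      G (not j) (map φ M₀ ++ y ∷ map χ E′ ++ W₂)
        ≡⟨ merged-block-sym (Setup-sym s) (not j) φ c R y W₂ (↭-trans (↭-sym (L₀↭M₀ s)) L₀↭) φc∈
             (cong suc lenW₁) (↭-sym χE′↭) (subst (λ n → n + _ ≡ _) (↭-length (L₀↭M₀ s)) len₁) ⟨
      G (not j) (map φ M₀ ++ y ∷ (x ∷ W₁) ++ W₂) ∎
    where
    χ-p : χ p ≡ x
    χ-p = proj₁ (∷-injective χ-pq)
    χ-q : χ q ≡ y
    χ-q = proj₁ (∷-injective (proj₂ (∷-injective χ-pq)))
    χ-S : map χ S ≡ W₁
    χ-S = proj₂ (∷-injective (proj₂ (∷-injective χ-pq)))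
    χE↭ : map χ E ↭ y ∷ W₁
    χE↭ = ↭-trans (map-↭ χ E↭) (↭-reflexive (cong₂ _∷_ χ-q χ-S))
    χE′↭ : map χ E′ ↭ x ∷ W₁
    χE′↭ = ↭-trans (map-↭ χ E′↭) (↭-reflexive (cong₂ _∷_ χ-p χ-S))
    χ≗φ : map χ (c ∷ R) ≡ map φ (c ∷ R)
    χ≗φ = map-agree L₀ χ-L₀ (∈-resp-↭ (↭-sym L₀↭))
    χc∈ : χ c ∈ map χ (R ++ p ∷ E)
    χc∈ = subst (χ c ∈_) (sym (map-++ χ R (p ∷ E))) (∈-++⁺ˡ
      (subst₂ _∈_ (sym (proj₁ (∷-injective χ≗φ))) (sym (proj₂ (∷-injective χ≗φ))) φc∈))
    len₁ : length L₀ + (suc (suc e) + length W₂) ≡ suc r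
    len₁ = begin
      length L₀ + suc (suc (e + length W₂))        ≡⟨ +-suc (length L₀) _ ⟩
      suc (length L₀ + suc (e + length W₂))        ≡⟨ cong (λ n → suc (length L₀ + suc (n + length W₂)))
          lenW₁ ⟨
      suc (length L₀ + suc (length W₁ + length W₂)) ≡⟨ cong (λ n → suc (length L₀ + suc n)) (length-++ W₁) ⟨
      suc (length L₀ + suc (length (W₁ ++ W₂)))    ≡⟨ cong suc len ⟩
      suc r                                        ∎
    len₂ : length (L₀ ++ p ∷ E) + length W₂ ≡ suc r
    len₂ = trans (cong (_+ length W₂) (trans (length-++ L₀) (cong (length L₀ +_) (length-D s))))
             (trans (+-assoc (length L₀) (suc (suc e)) (length W₂)) len₁)

  -- Three exchanges of ends, each changing the version, and three transpositions of symmetric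
  -- letters, which preserve it, compose to the identity. The transpositions require two symmetric
  -- letters, hence a block of at least three points.
  sign-invariant : Setup F G L₀ D M₀ D′ k r (suc e) → Injects F G (L₀ ++ D) (M₀ ++ D′) r →
    length L₀ + suc (suc (suc e)) ≤ r →
    ∀ j v W → length v ≡ length L₀ → length L₀ + length W ≡ r → F j (v ++ W) ≡ F (not j) (v ++ W)
  sign-invariant {F} {L₀ = L₀} {r = r} {e = e} s inj N+d≤r j v W lenv len
    with +-cancelˡ-≤ (length L₀) _ _ (≤-trans N+d≤r (≤-reflexive (sym len)))
  ... | d≤W with splitLength (suc (suc e)) W (≤-trans (n≤1+n _) d≤W)
  ... | y , [] , refl , leny =
    ⊥-elim (<-irrefl (sym (trans (cong length (++-identityʳ y)) leny)) d≤W)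
  ... | x′ ∷ z₁ ∷ z , x ∷ w , refl , lenz = begin
    F j (v ++ x′ ∷ z₁ ∷ z ++ x ∷ w)       ≡⟨ ends-swap′ s inj j v x (z₁ ∷ z) x′ w lenv lenz₁ len₁ ⟩
    F (not j) (v ++ x ∷ z₁ ∷ z ++ x′ ∷ w) ≡⟨ sym-first (not j) x z₁ x′ ⟩
    F (not j) (v ++ z₁ ∷ x ∷ z ++ x′ ∷ w) ≡⟨ ends-swap′ s inj (not j) v x′ (x ∷ z) z₁ w lenv lenz₁ len₁ ⟩
    F (not (not j)) (v ++ x′ ∷ x ∷ z ++ z₁ ∷ w) ≡⟨ cong (λ i → F i _) (not-involutive j) ⟩
    F j (v ++ x′ ∷ x ∷ z ++ z₁ ∷ w)       ≡⟨ sym-first j x′ x z₁ ⟩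
    F j (v ++ x ∷ x′ ∷ z ++ z₁ ∷ w)       ≡⟨ ends-swap′ s inj j v z₁ (x′ ∷ z) x w lenv lenz₁ len₁ ⟩
    F (not j) (v ++ z₁ ∷ x′ ∷ z ++ x ∷ w) ≡⟨ sym-first (not j) z₁ x′ x ⟩
    F (not j) (v ++ x′ ∷ z₁ ∷ z ++ x ∷ w) ∎
    where
    lenz₁ : suc (length z) ≡ suc e
    lenz₁ = suc-injective lenz
    len₁ : length L₀ + (suc (suc (suc e)) + length w) ≡ r
    len₁ = trans (cong (length L₀ +_) (trans (cong (λ n → suc n + length w) (sym lenz))
      (trans (sym (+-suc (suc (suc (length z))) (length w))) (cong (suc ∘ suc) (sym (length-++ z)))))) len
    sym-first : ∀ j x y z′ → F j (v ++ x ∷ y ∷ z ++ z′ ∷ w) ≡ F j (v ++ y ∷ x ∷ z ++ z′ ∷ w)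
    sym-first j x y z′ = block-sym s j v (z′ ∷ w) lenv lenz (swap x y refl)
      (trans (cong (length L₀ +_) (+-suc (suc (suc (suc e))) (length w)))
          (trans (+-suc (length L₀) _) (cong suc len₁)))

  block-pair-swap : Setup F G L₀ D M₀ D′ k r (suc e) → length L₀ + suc (suc (suc e)) ≤ suc r →
    ∀ j v x y W → length v ≡ length L₀ → length L₀ + suc (suc (length W)) ≡ r →
    F j (v ++ x ∷ y ∷ W) ≡ F j (v ++ y ∷ x ∷ W)
  block-pair-swap {L₀ = L₀} {r = r} {e = e} s N+d≤1+r j v x y W lenv len
    with splitLength e W (+-cancelˡ-≤ 3 _ _ (+-cancelˡ-≤ (length L₀) _ _ (≤-trans N+d≤1+r
           (≤-reflexive (sym (trans (+-suc (length L₀) _) (cong suc len)))))))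
  ... | W₁ , W₂ , refl , refl =
    block-sym s j v W₂ lenv refl (swap x y refl)
      (trans (+-suc (length L₀) _) (cong suc (trans
          (cong (λ n → length L₀ + suc (suc n)) (sym (length-++ W₁))) len)))

  -- For two points this is the exchange of ends with nothing in between. In a larger block both
  -- letters are symmetric, and the versions agree by `sign-invariant`.
  letters-swap : Setup F G L₀ D M₀ D′ k r e → Injects F G (L₀ ++ D) (M₀ ++ D′) r →
    length L₀ + suc (suc e) ≤ r →
    ∀ j v x y W → length v ≡ length L₀ → length L₀ + suc (suc (length W)) ≡ r →
    F j (v ++ x ∷ y ∷ W) ≡ F (not j) (v ++ y ∷ x ∷ W)
  letters-swap {e = zero}  s inj N+d≤r j v x y W lenv len = ends-swap′ s inj j v y [] x W lenv refl len
  letters-swap {F} {L₀ = L₀} {r = r} {e = suc e} s inj N+d≤r j v x y W lenv len =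
    trans (block-pair-swap s (≤-trans N+d≤r (n≤1+n r)) j v x y W lenv len)
          (sign-invariant s inj N+d≤r j v (y ∷ x ∷ W) lenv len)

-- Peeling off the last block

-- Each peeled transposition of two adjacent points exchanges the two versions of
-- G, and every block that is not such a transposition makes them equal.
twisted : ℕ → Bool
twisted zero          = false
twisted (suc zero)    = false
twisted (suc (suc n)) = not (twisted n)

swapLast : List A → List A
swapLast (x ∷ y ∷ [])        = y ∷ x ∷ []
swapLast (x ∷ xs@(_ ∷ _ ∷ _)) = x ∷ swapLast xs
swapLast xs                  = xs

swapLast-++ : ∀ (u : List A) x y v → swapLast (u ++ x ∷ y ∷ v) ≡ u ++ swapLast (x ∷ y ∷ v)
swapLast-++ []              x y v = refl
swapLast-++ (_ ∷ [])        x y v = refl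
swapLast-++ (a ∷ u@(_ ∷ [])) x y v = cong (a ∷_) (swapLast-++ u x y v)
swapLast-++ (a ∷ u@(_ ∷ _ ∷ _)) x y v = cong (a ∷_) (swapLast-++ u x y v)

-- With two letters behind the repetition, `swapLast` leaves the repeated letter and all before it
-- in place.
swapLast-leftRegular : ∀ {F : List A → B} → LeftRegular 0 F → LeftRegular 2 (F ∘ swapLast)
swapLast-leftRegular {F = F} lr .absorb u {x} (y ∷ z ∷ v) x∈u _ = begin
  F (swapLast (u ++ x ∷ y ∷ z ∷ v))   ≡⟨ cong F (swapLast-++ u x y (z ∷ v)) ⟩
  F (u ++ x ∷ swapLast (y ∷ z ∷ v))   ≡⟨ absorb lr u _ x∈u z≤n ⟩
  F (u ++ swapLast (y ∷ z ∷ v))       ≡⟨ cong F (swapLast-++ u y z v) ⟨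
  F (swapLast (u ++ y ∷ z ∷ v))       ∎
  where open ≡-Reasoning
swapLast-leftRegular lr .absorb u (y ∷ []) x∈u (s≤s ())

module Peel {p a b} {P : Set p} (_≟_ : DecidableEquality P) {A : Set a} {B : Set b} (x₀ : A) where
  open Core _≟_ {A = A} {B = B} x₀
  open Setup
  open Merges
  open Injects
  open ≡-Reasoning

  private
    variable
      F G : Bool → List A → B
      L M L₀ M₀ D D′ : List P
      k r e : ℕ

  -- Six exchanges realise the identity: the two prefix letters return to their
  -- places and the signs cancel.
  exchanges-cancel : ∀ {U U′ : List A} {m} →
    (∀ j x y z W → length W ≡ m → F j (U ++ x ∷ y ∷ z ∷ W) ≡ G (not j) (U′ ++ y ∷ x ∷ z ∷ W)) →
    (∀ j x y z W → length W ≡ m → F j (U ++ x ∷ y ∷ z ∷ W) ≡ F (not j) (U ++ x ∷ z ∷ y ∷ W)) →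
    (∀ j x y z W → length W ≡ m → G j (U′ ++ x ∷ y ∷ z ∷ W) ≡ G (not j) (U′ ++ x ∷ z ∷ y ∷ W)) →
    ∀ j x y z W → length W ≡ m → F j (U ++ x ∷ y ∷ z ∷ W) ≡ G j (U′ ++ x ∷ y ∷ z ∷ W)
  exchanges-cancel {F} {G} {U} {U′} exchange swapF swapG j x y z W lenW = begin
    F j (U ++ x ∷ y ∷ z ∷ W)              ≡⟨ exchange j x y z W lenW ⟩
    G (not j) (U′ ++ y ∷ x ∷ z ∷ W)       ≡⟨ swapG (not j) y x z W lenW ⟩
    G (not (not j)) (U′ ++ y ∷ z ∷ x ∷ W) ≡⟨ exchange (not j) z y x W lenW ⟨
    F (not j) (U ++ z ∷ y ∷ x ∷ W)        ≡⟨ swapF (not j) z y x W lenW ⟩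
    F (not (not j)) (U ++ z ∷ x ∷ y ∷ W)  ≡⟨ exchange (not (not j)) z x y W lenW ⟩
    G (not (not (not j))) (U′ ++ x ∷ z ∷ y ∷ W) ≡⟨ cong (λ i → G i _) (not-involutive (not j)) ⟩
    G (not j) (U′ ++ x ∷ z ∷ y ∷ W)       ≡⟨ swapG (not j) x z y W lenW ⟩
    G (not (not j)) (U′ ++ x ∷ y ∷ z ∷ W) ≡⟨ cong (λ i → G i _) (not-involutive j) ⟩
    G j (U′ ++ x ∷ y ∷ z ∷ W)             ∎

  -- The repeated label of `L₀` is absorbed and `x` joins the prefix instead, so an identity behind
  -- prefixes of that length also holds one place further right.
  at-merged-prefix : ∀ {H H′ : List A → B} → LeftRegular k H → LeftRegular k H′ →
    ∀ (φ : P → A) {c R} → L₀ ↭ c ∷ R → φ c ∈ map φ R → ∀ T T′ → k ≤ suc (length T) → length T ≡ length T′ →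
    (∀ v → length v ≡ length L₀ → H (v ++ T) ≡ H′ (v ++ T′)) →
    ∀ x → H (map φ L₀ ++ x ∷ T) ≡ H′ (map φ L₀ ++ x ∷ T′)
  at-merged-prefix {L₀ = L₀} {H = H} {H′} lr lr′ φ L₀↭ φc∈ T T′ k≤ eq h x
    with s , lens , delete ← merged-word φ L₀↭ φc∈ = begin
      H (map φ L₀ ++ x ∷ T)     ≡⟨ delete lr (x ∷ T) k≤ ⟩
      H (s ++ x ∷ T)            ≡⟨ cong H (++-assoc s [ x ] T) ⟨
      H ((s ++ [ x ]) ++ T)     ≡⟨ h (s ++ [ x ]) (trans (trans (length-++ s) (+-comm (length s) 1)) lens) ⟩
      H′ ((s ++ [ x ]) ++ T′)   ≡⟨ cong H′ (++-assoc s [ x ] T′) ⟩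
      H′ (s ++ x ∷ T′)          ≡⟨ delete lr′ (x ∷ T′) (subst (λ n → _ ≤ suc n) eq k≤) ⟨
      H′ (map φ L₀ ++ x ∷ T′)   ∎

  -- `merged-letters-swap` gives the exchange, `at-merged-prefix` moves the swap hypotheses one
  -- place to the right, and `exchanges-cancel` combines them. The outcome links equal versions,
  -- hence `G ∘ not`.
  peel-merges : Setup F G L₀ D M₀ D′ k r e → length L₀ + 2 ≤ r →
    (∀ j v x y W → length v ≡ length L₀ → length L₀ + suc (suc (length W)) ≡ r →
      F j (v ++ x ∷ y ∷ W) ≡ F (not j) (v ++ y ∷ x ∷ W)) →
    (∀ j v x y W → length v ≡ length M₀ → length M₀ + suc (suc (length W)) ≡ r →
      G j (v ++ x ∷ y ∷ W) ≡ G (not j) (v ++ y ∷ x ∷ W)) →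
    Merges F (G ∘ not) L₀ M₀ r
  peel-merges {F} {G} {L₀} {M₀ = M₀} {k = k} {r = r} {e = e} s N+2≤r swapF swapG .merge j φ c R w L₀↭
      φc∈ len′
    -- Since `length L₀ + 2 ≤ r`, the tail contains the three letters that `exchanges-cancel`
    -- permutes.
    with w | len′ | +-cancelˡ-≤ (length L₀) 3 (length w)
          (≤-trans (≤-reflexive (+-suc (length L₀) 2)) (≤-trans (s≤s N+2≤r) (≤-reflexive (sym len′))))
  ... | []         | _ | ()
  ... | _ ∷ []     | _ | s≤s ()
  ... | _ ∷ _ ∷ [] | _ | s≤s (s≤s ())
  ... | x ∷ y ∷ z ∷ W | len | _ = trans
    (exchanges-cancel {F = F} {G = G} {m = length W}
      (λ j x y z W′ lenW → merged-letters-swap s j φ c R x y (z ∷ W′) L₀↭ φc∈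
          (trans (cong (λ n → length L₀ + suc (suc n)) lenW) len₁))
      (λ j x y z W′ lenW → at-merged-prefix (lrF s j) (lrF s (not j)) φ L₀↭ φc∈ (y ∷ z ∷ W′)
          (z ∷ y ∷ W′) (k≤ W′ lenW) refl
        (λ v lenv → swapF j v y z W′ lenv (trans (cong (λ n → length L₀ + suc (suc n)) lenW) len₁)) x)
      (λ j x y z W′ lenW → at-merged-prefix (lrG s j) (lrG s (not j)) φ (↭-trans (↭-sym (L₀↭M₀ s)) L₀↭)
          φc∈ (y ∷ z ∷ W′) (z ∷ y ∷ W′) (k≤ W′ lenW) refl
        (λ v lenv → swapG j v y z W′ lenv (trans
            (cong₂ (λ m n → m + suc (suc n)) (↭-length (↭-sym (L₀↭M₀ s))) lenW) len₁)) x)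
      j x y z W refl)
    (cong (λ i → G i _) (sym (not-involutive j)))
    where
    len₁ : length L₀ + suc (suc (length W)) ≡ r
    len₁ = suc-injective (trans (sym (+-suc (length L₀) _)) len)
    k≤ : ∀ W′ → length W′ ≡ length W → k ≤ suc (suc (suc (length W′)))
    k≤ W′ lenW = ≤-trans (m≤n+m k (suc (suc e))) (+-cancelˡ-≤ (length L₀) _ _ (≤-trans (bound s)
      (≤-reflexive (trans (sym len) (cong (λ n → length L₀ + suc (suc (suc n))) (sym lenW))))))

  -- `block-const` relates `F false` to `G true`, the `false` version of `G ∘ not`.
  peel-injects : Setup F G L₀ D M₀ D′ k r e → length L₀ + suc (suc e) ≤ suc r → Injects F (G ∘ not) L₀ M₀ r
  peel-injects {F} {G} {L₀} {r = r} {e = e} s N+d≤1+r .inject φ w len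
    with y , w′ , refl , leny ← splitLength (suc e) w (+-cancelˡ-≤ (length L₀) _ _ (≤-pred
           (≤-trans (≤-reflexive (sym (+-suc (length L₀) (suc e))))
               (≤-trans N+d≤1+r (s≤s (≤-reflexive (sym len))))))) =
    block-const s false φ w′ leny refl (trans (+-suc (length L₀) _) (cong suc
      (trans (cong (length L₀ +_) (trans (cong (_+ length w′) (sym leny)) (sym (length-++ y)))) len)))

  relabel-last : ∀ {q} → Unique (L₀ ++ [ q ]) → L₀ ↭ M₀ → ∀ (φ : P → A) x w →
    ∃ λ χ → map χ L₀ ≡ map φ L₀ × χ q ≡ x ×
            map χ (L₀ ++ [ q ]) ++ w ≡ map φ L₀ ++ x ∷ w × map χ (M₀ ++ [ q ]) ++ w ≡ map φ M₀ ++ x ∷ w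
  relabel-last {L₀} {M₀} {q} uniq L₀↭M₀ φ x w
    with χ , χ-L₀ , χ-M₀ , χ-q ← relabelled uniq L₀↭M₀ φ [ x ] refl =
    χ , χ-L₀ , proj₁ (∷-injective χ-q)
    , trans (map-++-++ χ L₀ [ q ] w) (cong₂ (λ u v → u ++ v ++ w) χ-L₀ χ-q)
    , trans (map-++-++ χ M₀ [ q ] w) (cong₂ (λ u v → u ++ v ++ w) χ-M₀ χ-q)

  length-snoc : ∀ (xs : List P) {q n m} → length xs + suc n ≡ m → length (xs ++ [ q ]) + n ≡ m
  length-snoc xs {n = n} len = trans (cong (_+ n) (length-++ xs)) (trans (+-assoc (length xs) 1 n) len)

  -- The common last point is labelled with the first letter of the tail, which is nonempty by the
  -- bound on `length L₀`.
  single-merges : ∀ {q} → Unique (L₀ ++ [ q ]) → L₀ ↭ M₀ → length L₀ ≤ r →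
                  Merges F G (L₀ ++ [ q ]) (M₀ ++ [ q ]) r → Merges F G L₀ M₀ r
  single-merges {L₀ = L₀} uniq L₀↭M₀ N≤r mg .merge j φ c R [] L₀↭ φc∈ len =
    ⊥-elim (<-irrefl (trans (sym (+-identityʳ (length L₀))) len) (s≤s N≤r))
  single-merges {L₀ = L₀} {F = F} {G = G} {q} uniq L₀↭M₀ N≤r mg .merge j φ c R (x ∷ w) L₀↭ φc∈ len
    with χ , χ-L₀ , χ-q , χ-L , χ-M ← relabel-last uniq L₀↭M₀ φ x w =
    trans (cong (F j) (sym χ-L)) (trans (mg .merge j χ c (R ++ [ q ]) w (++⁺ʳ [ q ] L₀↭) χc∈
        (length-snoc L₀ len))
      (cong (G (not j)) χ-M))
    where
    χ≗φ : map χ (c ∷ R) ≡ map φ (c ∷ R)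
    χ≗φ = map-agree L₀ χ-L₀ (∈-resp-↭ (↭-sym L₀↭))
    χc∈ : χ c ∈ map χ (R ++ [ q ])
    χc∈ = subst (χ c ∈_) (sym (map-++ χ R [ q ])) (∈-++⁺ˡ
      (subst₂ _∈_ (sym (proj₁ (∷-injective χ≗φ))) (sym (proj₂ (∷-injective χ≗φ))) φc∈))

  single-injects : ∀ {q} → Unique (L₀ ++ [ q ]) → L₀ ↭ M₀ → length L₀ < r →
                   Injects F G (L₀ ++ [ q ]) (M₀ ++ [ q ]) r → Injects F G L₀ M₀ r
  single-injects {L₀ = L₀} uniq L₀↭M₀ N<r inj .inject φ [] len =
    ⊥-elim (<-irrefl (trans (sym (+-identityʳ (length L₀))) len) N<r)
  single-injects {L₀ = L₀} {F = F} {G = G} uniq L₀↭M₀ N<r inj .inject φ (x ∷ w) len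
    with χ , _ , _ , χ-L , χ-M ← relabel-last uniq L₀↭M₀ φ x w =
    trans (cong (F false) (sym χ-L)) (trans (inj .inject χ w (length-snoc L₀ len)) (cong (G false) χ-M))

  -- The last point can be given a fresh letter or merged with an earlier point;
  -- the two choices relate F false to both versions of G.
  single-collapse : ∀ {q} → (∀ j → LeftRegular k (F j)) → (∀ j → LeftRegular k (G j)) →
    Unique (L₀ ++ [ q ]) → L₀ ↭ M₀ → 0 < length L₀ → length L₀ + suc k ≤ suc r →
    Merges F G (L₀ ++ [ q ]) (M₀ ++ [ q ]) r → Injects F G L₀ M₀ r →
    ∀ ω → length ω ≡ r → G false ω ≡ G true ω
  single-collapse {k} {F} {G} {L₀ = L₀@(c ∷ L₁)} {M₀ = M₀} {r = r} {q} lrF lrG uniq L₀↭M₀ _ bound mg inj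
      ω lenω
    with v , w , refl , lenv ← splitLength (length M₀) ω
           (≤-trans (≤-reflexive (↭-length (↭-sym L₀↭M₀))) (≤-trans (m≤m+n (length L₀) k)
             (≤-trans (≤-pred (≤-trans (≤-reflexive (sym (+-suc (length L₀) k))) bound))
                 (≤-reflexive (sym lenω)))))
    with φ , refl ← labelled (Unique-resp-↭ L₀↭M₀ (Unique-++⁻ˡ L₀ uniq)) v lenv
    with χ , χ-L₀ , χ-q , χ-L , χ-M ← relabel-last uniq L₀↭M₀ φ (φ c) w = begin
      G false (map φ M₀ ++ w)         ≡⟨ inj .inject φ w len ⟨
      F false (map φ L₀ ++ w)         ≡⟨ absorb (lrF false) (map φ L₀) w (here refl) k≤w ⟨
      F false (map φ L₀ ++ φ c ∷ w)   ≡⟨ cong (F false) χ-L ⟨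
      F false (map χ (L₀ ++ [ q ]) ++ w) ≡⟨ mg .merge false χ q L₀ w (++-comm L₀ [ q ])
                                             (subst₂ _∈_ (sym χ-q) (sym χ-L₀) (here refl))
                                                 (length-snoc L₀ (trans (+-suc (length L₀) _)
                                                     (cong suc len))) ⟩
      G true (map χ (M₀ ++ [ q ]) ++ w) ≡⟨ cong (G true) χ-M ⟩
      G true (map φ M₀ ++ φ c ∷ w)    ≡⟨ absorb (lrG true) (map φ M₀) w
          (∈-map⁺ φ (∈-resp-↭ L₀↭M₀ (here refl))) k≤w ⟩
      G true (map φ M₀ ++ w)          ∎
    where
    len : length L₀ + length w ≡ r
    len = trans (cong (_+ length w) (trans (↭-length L₀↭M₀) (sym lenv)))
        (trans (sym (length-++ (map φ M₀))) lenω)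
    k≤w : k ≤ length w
    k≤w = +-cancelˡ-≤ (length L₀) _ _ (≤-pred (≤-trans (≤-reflexive (sym (+-suc (length L₀) k)))
            (≤-trans bound (s≤s (≤-reflexive (sym len))))))

  collapse : ∀ {G : Bool → List A → B} {ω} → G false ω ≡ G true ω → ∀ i j → G i ω ≡ G j ω
  collapse e false false = refl
  collapse e false true  = e
  collapse e true  false = sym e
  collapse e true  true  = refl

  -- The recursion `rec` is applied to `G` for a single point and to `G ∘ not` for a larger block. A
  -- single point behind others shifts the argument of `twisted` by one; this is harmless because
  -- both versions of `G` then agree at `ω`.
  peel-last : (∀ j → LeftRegular k (F j)) → (∀ j → LeftRegular k (G j)) → Unique (L₀ ++ D) →
    L₀ ↭ M₀ → D ↭ D′ → 0 < length D → Indecomposable D D′ →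
    length (L₀ ++ D) ≤ r → length (L₀ ++ D) + k ≤ suc r →
    Merges F G (L₀ ++ D) (M₀ ++ D′) r → Injects F G (L₀ ++ D) (M₀ ++ D′) r →
    (∀ {G′} → (∀ j → LeftRegular k (G′ j)) → Merges F G′ L₀ M₀ r → Injects F G′ L₀ M₀ r →
      ∀ ω → length ω ≡ r → F false ω ≡ G′ (twisted (length L₀)) ω) →
    ∀ ω → length ω ≡ r → F false ω ≡ G (twisted (length (L₀ ++ D))) ω
  peel-last {L₀ = []} {D = q ∷ []} {M₀ = M₀} lrF lrG uniq L₀↭M₀ D↭D′ _ ind L≤r bound mg inj rec (x ∷ ω) lenω
    with refl ← ↭-empty-inv (↭-sym L₀↭M₀) | refl ← ↭-singleton-inv (↭-sym D↭D′) =
    inj .inject (λ _ → x) ω lenω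
  peel-last {L₀ = []} {D = q ∷ []} lrF lrG uniq L₀↭M₀ D↭D′ _ ind L≤r bound mg inj rec [] lenω
    with () ← ≤-trans L≤r (≤-reflexive (sym lenω))
  peel-last {k} {F} {G} {L₀ = L₀@(_ ∷ _)} {D = q ∷ []} {r = r} lrF lrG uniq L₀↭M₀ D↭D′ _ ind L≤r bound
      mg inj rec ω lenω
    with refl ← ↭-singleton-inv (↭-sym D↭D′) =
    trans (rec lrG (single-merges uniq L₀↭M₀ (<⇒≤ N<r) mg) inj₀ ω lenω)
          (collapse {G = G} (single-collapse lrF lrG uniq L₀↭M₀ (s≤s z≤n) bound′ mg inj₀ ω lenω) _ _)
    where
    N+1 : length (L₀ ++ [ q ]) ≡ suc (length L₀)
    N+1 = trans (length-++ L₀) (+-comm (length L₀) 1)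
    N<r : length L₀ < r
    N<r = ≤-trans (≤-reflexive (sym N+1)) L≤r
    bound′ : length L₀ + suc k ≤ suc r
    bound′ = ≤-trans (≤-reflexive (trans (+-suc (length L₀) k) (cong (_+ k) (sym N+1)))) bound
    inj₀ = single-injects uniq L₀↭M₀ N<r inj
  peel-last {k} {F} {G} {L₀ = L₀} {D = D@(_ ∷ _ ∷ D₁)} {M₀ = M₀} {r = r} lrF lrG uniq L₀↭M₀ D↭D′ _ ind
      L≤r bound mg inj rec ω lenω =
    trans (rec (λ j → lrG (not j)) (peel-merges setup
        (≤-trans (+-monoʳ-≤ (length L₀) (s≤s (s≤s z≤n))) N+d≤r)
                   (letters-swap setup inj N+d≤r) (letters-swap setup′ inj′ N′+d≤r))
                 (peel-injects setup (≤-trans N+d≤r (n≤1+n r))) ω lenω)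
          (trans (untwist D₁ refl) (cong (λ n → G (twisted n) ω) (sym (length-++ L₀))))
    where
    N+d≤r : length L₀ + suc (suc (length D₁)) ≤ r
    N+d≤r = ≤-trans (≤-reflexive (sym (length-++ L₀))) L≤r
    N′+d≤r : length M₀ + suc (suc (length D₁)) ≤ r
    N′+d≤r = subst (λ n → n + _ ≤ r) (↭-length L₀↭M₀) N+d≤r
    setup : Setup F G L₀ D M₀ _ k r (length D₁)
    setup = record
      { lrF = lrF ; lrG = lrG ; uniq = uniq ; L₀↭M₀ = L₀↭M₀ ; D↭D′ = D↭D′ ; length-D = refl
      ; bound = ≤-trans (≤-reflexive (trans (sym (+-assoc (length L₀) _ k))
          (cong (_+ k) (sym (length-++ L₀))))) bound
      ; indecomposable = ind ; merges = mg }
    setup′ = Setup-sym setup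
    inj′ = Injects-sym (++⁺ L₀↭M₀ D↭D′) inj
    -- For two points `twisted` changes by one negation; for more points the versions agree at `ω`.
    untwist : ∀ E → length E ≡ length D₁ →
              G (not (twisted (length L₀))) ω ≡ G (twisted (length L₀ + suc (suc (length D₁)))) ω
    untwist []      e rewrite sym e = cong (λ n → G (twisted n) ω) (+-comm 2 (length L₀))
    untwist (_ ∷ E) e
      with v , w , refl , lenv ← splitLength (length M₀) ω
            (≤-trans (m≤m+n _ _) (≤-trans N′+d≤r (≤-reflexive (sym lenω))))
      = collapse {G = G} (sign-invariant
          (subst (Setup G F M₀ _ L₀ D k r) (sym e) setup′) inj′
          (subst (λ m → length M₀ + suc (suc m) ≤ r) (sym e) N′+d≤r)
          false v w lenv (trans (cong (_+ length w) (sym lenv)) (trans (sym (length-++ v)) lenω))) _ _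

  -- If all blocks are transpositions, except possibly an initial single point, `twisted (length L)`
  -- is the parity of the number of transpositions. Otherwise the versions of `G` agree at `ω`, and
  -- either index is correct.
  peel : ∀ n {F G} L M → length L ≤ n → Unique L → L ↭ M →
    (∀ j → LeftRegular k (F j)) → (∀ j → LeftRegular k (G j)) →
    length L ≤ r → length L + k ≤ suc r → Merges F G L M r → Injects F G L M r →
    ∀ ω → length ω ≡ r → F false ω ≡ G (twisted (length L)) ω
  peel n [] M _ _ L↭M _ _ _ _ _ inj ω lenω with refl ← ↭-empty-inv (↭-sym L↭M) =
    inj .inject (λ _ → x₀) ω lenω
  peel {k} {r} (suc n) {F} {G} L@(_ ∷ L₁) M (s≤s L≤n) uniq L↭M lrF lrG L≤r bound mg inj ω lenω
    with lastBlock _≟_ (length L) L M ≤-refl uniq L↭M (s≤s z≤n)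
  ... | record { L₀ = L₀ ; D = D ; L≡ = L≡ ; M≡ = refl ; L₀↭M₀ = L₀↭M₀ ; D↭D′ = D↭D′
               ; D-nonempty = D-nonempty ; indecomposable = ind } =
      subst (λ L → F false ω ≡ G (twisted (length L)) ω) (sym L≡)
        (peel-last lrF lrG (subst Unique L≡ uniq) L₀↭M₀ D↭D′ D-nonempty ind
          (subst (λ L → length L ≤ r) L≡ L≤r) (subst (λ L → length L + k ≤ suc r) L≡ bound)
          (subst (λ L → Merges F G L M r) L≡ mg) (subst (λ L → Injects F G L M r) L≡ inj)
          (λ lrG′ → peel n L₀ _ (≤-pred (≤-trans N<L (s≤s L≤n))) (Unique-++⁻ˡ L₀ (subst Unique L≡ uniq))
              L₀↭M₀ lrF lrG′
             (≤-trans (<⇒≤ N<L) L≤r) (≤-trans (+-monoˡ-≤ k (<⇒≤ N<L)) bound))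
          ω lenω)
      where
      N<L : length L₀ < length L
      N<L = ≤-trans (≤-trans (≤-reflexive (+-comm 1 _)) (+-monoʳ-≤ (length L₀) D-nonempty))
              (≤-reflexive (trans (sym (length-++ L₀)) (cong length (sym L≡))))

  -- The first block to be peeled

  signed : (List A → B) → Bool → List A → B
  signed H false = H
  signed H true  = H ∘ swapLast

  signed-leftRegular : ∀ {H} → LeftRegular 0 H → ∀ j → LeftRegular 2 (signed H j)
  signed-leftRegular lr false .absorb u v x∈u _ = absorb lr u v x∈u z≤n
  signed-leftRegular lr true = swapLast-leftRegular lr

  -- The length condition leaves exactly two letters in the tail. They are the ones exchanged by
  -- `merged-letters-swap`, which is why the `true` version is composition with `swapLast`.
  signed-merges : ∀ {F G : List A → B} → Setup (λ _ → F) (λ _ → G) L₀ D M₀ D′ k r 0 → length L₀ + 1 ≡ r →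
                  Merges (signed F) (signed G) L₀ M₀ r
  signed-merges {L₀} {M₀ = M₀} {F = F} {G = G} s N+1≡r .merge j φ c R w L₀↭ φc∈ len
    with w | +-cancelˡ-≡ (length L₀) (length w) 2
          (trans len (trans (cong suc (sym N+1≡r)) (sym (+-suc (length L₀) 1))))
  signed-merges {L₀} {M₀ = M₀} {F = F} {G = G} s N+1≡r .merge false φ c R w L₀↭ φc∈ len | x ∷ y ∷ [] | _ =
    trans (merged-letters-swap s false φ c R x y [] L₀↭ φc∈ N+1≡r)
        (cong G (sym (swapLast-++ (map φ M₀) x y [])))
  signed-merges {L₀} {M₀ = M₀} {F = F} {G = G} s N+1≡r .merge true φ c R w L₀↭ φc∈ len | x ∷ y ∷ [] | _ =
    trans (cong F (swapLast-++ (map φ L₀) x y [])) (merged-letters-swap s false φ c R y x [] L₀↭ φc∈ N+1≡r)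

  module _ {F G : List A → B} (lrF : LeftRegular 0 F) (lrG : LeftRegular 0 G) where

    unsigned-merges : (∀ φ → F (map φ L) ≡ G (map φ M)) → length L ≡ suc r → Merges (λ _ → F) (λ _ → G)
        L M r
    unsigned-merges {L} {M} h len .merge j φ c R []      _ _ _ =
      trans (cong F (++-identityʳ (map φ L))) (trans (h φ) (cong G (sym (++-identityʳ (map φ M)))))
    unsigned-merges {L} h len .merge j φ c R (_ ∷ w) _ _ len′
      with () ← +-cancelˡ-≡ (length L) (suc (length w)) 0
            (trans len′ (trans (sym len) (sym (+-identityʳ _))))

    -- The last point gets the label of the earlier point `c`, and its letter is absorbed on both
    -- sides.
    unsigned-injects : ∀ {q} → Unique (L₀ ++ [ q ]) → L₀ ↭ M₀ → length L₀ ≡ suc r →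
      (∀ φ → F (map φ (L₀ ++ [ q ])) ≡ G (map φ (M₀ ++ [ q ]))) →
      Injects (λ _ → F) (λ _ → G) L₀ M₀ (suc r)
    unsigned-injects {L₀ = L₀} uniq L₀↭M₀ lenL₀ h .inject φ (_ ∷ w) len
      with () ← +-cancelˡ-≡ (length L₀) (suc (length w)) 0
            (trans len (trans (sym lenL₀) (sym (+-identityʳ _))))
    unsigned-injects {L₀ = L₀@(c ∷ _)} {M₀} {q = q} uniq L₀↭M₀ lenL₀ h .inject φ [] len
      with χ , _ , _ , χ-L , χ-M ← relabel-last uniq L₀↭M₀ φ (φ c) [] = begin
        F (map φ L₀ ++ [])                ≡⟨ absorb lrF (map φ L₀) [] (here refl) z≤n ⟨
        F (map φ L₀ ++ φ c ∷ [])          ≡⟨ cong F (trans (sym χ-L) (++-identityʳ _)) ⟩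
        F (map χ (L₀ ++ [ q ]))           ≡⟨ h χ ⟩
        G (map χ (M₀ ++ [ q ]))           ≡⟨ cong G (trans (sym (++-identityʳ _)) χ-M) ⟩
        G (map φ M₀ ++ φ c ∷ [])          ≡⟨ absorb lrG (map φ M₀) []
            (∈-map⁺ φ (∈-resp-↭ L₀↭M₀ (here refl))) z≤n ⟩
        G (map φ M₀ ++ [])                ∎

    -- `L` has one point more than `ω` has letters, so `Injects` would be vacuous for `L` and the
    -- last block is removed separately. Only a last block of two points leads to the versions
    -- `signed`; otherwise constant families are peeled and no swap arises.
    equal-or-swapped : ∀ {r} (L M : List P) → Unique L → L ↭ M → length L ≡ suc (suc r) →
      (∀ φ → F (map φ L) ≡ G (map φ M)) → ∀ ω → length ω ≡ suc r →
      F ω ≡ G ω ⊎ twisted r ≡ true × F ω ≡ G (swapLast ω)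
    equal-or-swapped {r} L M uniq L↭M lenL h ω lenω
      with lastBlock _≟_ (length L) L M ≤-refl uniq L↭M (≤-trans (s≤s z≤n) (≤-reflexive (sym lenL)))
    ... | record { L₀ = L₀ ; D = q ∷ [] ; M₀ = M₀ ; L≡ = refl ; M≡ = refl ; L₀↭M₀ = L₀↭M₀ ; D↭D′ = D↭D′ }
      with refl ← ↭-singleton-inv (↭-sym D↭D′) = inj₁
        (peel {k = 0} (length L₀) {λ _ → F} {λ _ → G} L₀ M₀ ≤-refl (Unique-++⁻ˡ L₀ uniq) L₀↭M₀
            (λ _ → lrF) (λ _ → lrG)
          N≤r (≤-trans (≤-reflexive (+-identityʳ _)) (≤-trans N≤r (n≤1+n _)))
          (single-merges uniq L₀↭M₀ N≤r (unsigned-merges h lenL))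
          (unsigned-injects uniq L₀↭M₀ N≡r h) ω lenω)
      where
      N≡r : length L₀ ≡ suc r
      N≡r = suc-injective (trans (trans (+-comm 1 _) (sym (length-++ L₀))) lenL)
      N≤r : length L₀ ≤ suc r
      N≤r = ≤-reflexive N≡r
    ... | record { L₀ = L₀ ; D = D@(_ ∷ _ ∷ D₁) ; M₀ = M₀ ; L≡ = refl ; M≡ = refl ; L₀↭M₀ = L₀↭M₀ ; D↭D′
          = D↭D′
                 ; indecomposable = ind } = go D₁ refl
      where
      N+d : length L₀ + suc (suc (length D₁)) ≡ suc (suc r)
      N+d = trans (sym (length-++ L₀)) lenL
      setup : Setup (λ _ → F) (λ _ → G) L₀ D M₀ _ 0 (suc r) (length D₁)
      setup = record
        { lrF = λ _ → lrF ; lrG = λ _ → lrG ; uniq = uniq ; L₀↭M₀ = L₀↭M₀ ; D↭D′ = D↭D′ ; length-D = refl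
        ; bound = ≤-reflexive (trans (cong (length L₀ +_) (+-identityʳ _)) N+d)
        ; indecomposable = ind ; merges = unsigned-merges h lenL }
      go : ∀ E → length E ≡ length D₁ → F ω ≡ G ω ⊎ twisted r ≡ true × F ω ≡ G (swapLast ω)
      go [] 0≡ = signs (twisted (length L₀)) refl
        (peel {k = 2} (length L₀) {signed F} {signed G} L₀ M₀ ≤-refl (Unique-++⁻ˡ L₀ uniq) L₀↭M₀
          (signed-leftRegular lrF) (signed-leftRegular lrG)
          (≤-trans (n≤1+n _) (≤-reflexive (trans (+-comm 1 _) N+1≡r)))
          (≤-reflexive (trans (+-suc (length L₀) 1) (cong suc N+1≡r)))
          (signed-merges setup₀ N+1≡r) (record { inject = inj₀ .inject }) ω lenω)
        where
        setup₀ : Setup (λ _ → F) (λ _ → G) L₀ D M₀ _ 0 (suc r) 0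
        setup₀ = subst (Setup _ _ L₀ D M₀ _ 0 (suc r)) (sym 0≡) setup
        N+1≡r : length L₀ + 1 ≡ suc r
        N+1≡r = suc-injective (trans (sym (+-suc (length L₀) 1))
            (trans (cong (λ n → length L₀ + suc (suc n)) 0≡) N+d))
        N≡r : length L₀ ≡ r
        N≡r = suc-injective (trans (+-comm 1 _) N+1≡r)
        inj₀ = peel-injects setup (≤-reflexive N+d)
        signs : ∀ t → twisted (length L₀) ≡ t → F ω ≡ signed G t ω → F ω ≡ G ω ⊎ twisted r ≡ true × F ω
            ≡ G (swapLast ω)
        signs false _  e = inj₁ e
        signs true  tw e = inj₂ (trans (cong twisted (sym N≡r)) tw , e)
      -- With at least three points the first two letters of the block are symmetric, so the swap
      -- hypotheses of `peel-merges` hold for constant families.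
      go (_ ∷ E) e≡ = inj₁
        (peel {k = 0} (length L₀) {λ _ → F} {λ _ → G} L₀ M₀ ≤-refl (Unique-++⁻ˡ L₀ uniq) L₀↭M₀
            (λ _ → lrF) (λ _ → lrG)
          (≤-trans (m≤m+n _ 2) N+2≤r) (≤-trans (≤-reflexive (+-identityʳ _))
              (≤-trans (m≤m+n _ 2) (≤-trans N+2≤r (n≤1+n _))))
          (peel-merges setup₁ N+2≤r (block-pair-swap setup₁ N+d≤)
              (block-pair-swap (Setup-sym setup₁) (subst (λ n → n + _ ≤ _) (↭-length L₀↭M₀) N+d≤)))
          (peel-injects setup₁ N+d≤) ω lenω)
        where
        setup₁ : Setup (λ _ → F) (λ _ → G) L₀ D M₀ _ 0 (suc r) (suc (length E))
        setup₁ = subst (Setup _ _ L₀ D M₀ _ 0 (suc r)) (sym e≡) setup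
        N+d≤ : length L₀ + suc (suc (suc (length E))) ≤ suc (suc r)
        N+d≤ = ≤-reflexive (trans (cong (λ n → length L₀ + suc (suc n)) e≡) N+d)
        N+2≤r : length L₀ + 2 ≤ suc r
        N+2≤r = ≤-pred (≤-trans (≤-reflexive (sym (+-suc (length L₀) 2)))
                  (≤-trans (+-monoʳ-≤ (length L₀) (s≤s (s≤s (s≤s z≤n)))) N+d≤))

-- From decks to words

module _ (_≟_ : DecidableEquality A) where

  private
    except : A → List A → List A
    except x = filter (¬? ∘ (x ≟_))

  except-comm : ∀ x z xs → except x (except z xs) ≡ except z (except x xs)
  except-comm x z [] = refl
  except-comm x z (y ∷ xs) with z ≟ y in z? | x ≟ y in x?
  ... | yes _ | yes _ = except-comm x z xs
  ... | yes _ | no  _ rewrite z? = except-comm x z xs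
  ... | no _  | yes _ rewrite x? = except-comm x z xs
  ... | no _  | no  _ rewrite z? | x? = cong (y ∷_) (except-comm x z xs)

  except-deduplicate : ∀ x u v → except x (deduplicate _≟_ (u ++ x ∷ v)) ≡ except x
      (deduplicate _≟_ (u ++ v))
  except-deduplicate x [] v = trans (filter-reject (¬? ∘ (x ≟_)) (λ x≢x → x≢x refl))
      (filter-idem (¬? ∘ (x ≟_)) (deduplicate _≟_ v))
  except-deduplicate x (z ∷ u) v with x ≟ z
  ... | yes _ = trans (except-comm x z (deduplicate _≟_ (u ++ x ∷ v)))
        (trans (cong (except z) (except-deduplicate x u v)) (except-comm z x (deduplicate _≟_ (u ++ v))))
  ... | no _  = cong (z ∷_) (trans (except-comm x z (deduplicate _≟_ (u ++ x ∷ v)))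
        (trans (cong (except z) (except-deduplicate x u v)) (except-comm z x (deduplicate _≟_ (u ++ v)))))

  deduplicate-absorb : ∀ u {x} v → x ∈ u → deduplicate _≟_ (u ++ x ∷ v) ≡ deduplicate _≟_ (u ++ v)
  deduplicate-absorb (y ∷ u) v (here refl) = cong (y ∷_) (except-deduplicate y u v)
  deduplicate-absorb (y ∷ u) v (there x∈)  = cong (λ z → y ∷ except y z) (deduplicate-absorb u v x∈)

  absorb-except : ∀ {H : List B → P} → LeftRegular 0 H → ∀ (f : A → B) u x ys → f x ∈ u →
                  H (u ++ map f (except x ys)) ≡ H (u ++ map f ys)
  absorb-except lr f u x [] fx∈ = refl
  absorb-except {H = H} lr f u x (y ∷ ys) fx∈ with x ≟ y
  ... | yes refl = trans (absorb-except lr f u x ys fx∈) (sym (absorb lr u (map f ys) fx∈ z≤n))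
  ... | no _ = begin
    H (u ++ f y ∷ map f (except x ys))      ≡⟨ cong H (++-assoc u [ f y ] _) ⟨
    H ((u ++ [ f y ]) ++ map f (except x ys)) ≡⟨ absorb-except lr f (u ++ [ f y ]) x ys (∈-++⁺ˡ fx∈) ⟩
    H ((u ++ [ f y ]) ++ map f ys)          ≡⟨ cong H (++-assoc u [ f y ] _) ⟩
    H (u ++ f y ∷ map f ys)                 ∎
    where open ≡-Reasoning

  -- Repeated points receive repeated letters, which `H` absorbs. This passes from a list of places
  -- to the duplicate-free list of its points.
  absorb-deduplicate : ∀ {H : List B → P} → LeftRegular 0 H → ∀ (f : A → B) u xs →
                       H (u ++ map f (deduplicate _≟_ xs)) ≡ H (u ++ map f xs)
  absorb-deduplicate lr f u [] = refl
  absorb-deduplicate {H = H} lr f u (x ∷ xs) = begin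
    H (u ++ f x ∷ map f (except x (deduplicate _≟_ xs)))
      ≡⟨ cong H (++-assoc u [ f x ] _) ⟨
    H ((u ++ [ f x ]) ++ map f (except x (deduplicate _≟_ xs)))
      ≡⟨ absorb-except lr f (u ++ [ f x ]) x (deduplicate _≟_ xs) (∈-++⁺ʳ u (here refl)) ⟩
    H ((u ++ [ f x ]) ++ map f (deduplicate _≟_ xs))
      ≡⟨ absorb-deduplicate lr f (u ++ [ f x ]) xs ⟩
    H ((u ++ [ f x ]) ++ map f xs)
      ≡⟨ cong H (++-assoc u [ f x ] _) ⟩
    H (u ++ f x ∷ map f xs) ∎
    where open ≡-Reasoning

  -- The value b₀ at the empty word is never used.
  onWords : B → (A ♯ → B) → List A → B
  onWords b₀ f* []       = b₀
  onWords b₀ f* (x ∷ xs) = f* (tuple (deduplicate _≟_ (x ∷ xs)) _ (deduplicate-! _≟_ (x ∷ xs)))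

  onWords-leftRegular : ∀ (b₀ : B) f* → LeftRegular 0 (onWords b₀ f*)
  onWords-leftRegular b₀ f* .absorb (y ∷ u) v x∈ _ = tuple-cong (deduplicate-absorb (y ∷ u) v x∈)
    where
    tuple-cong : ∀ {xs ys} .{p q p′ q′} → xs ≡ ys → f* (tuple xs p q) ≡ f* (tuple ys p′ q′)
    tuple-cong refl = refl

  onWords-toList : ∀ (b₀ : B) f* {n} .{{_ : NonZero n}} (as : Vec A n) → onWords b₀ f* (toList as) ≡ f*
      (ofo _≟_ as)
  onWords-toList b₀ f* (x Vec.∷ as) = refl

-- Identification maps, tuples and counting

lower-inject₁ : ∀ {n} (j : Fin n) .(j< : toℕ (inject₁ j) < n) → lower (inject₁ j) j< ≡ j
lower-inject₁ Fin.zero    _  = refl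
lower-inject₁ (Fin.suc j) j< = cong Fin.suc (lower-inject₁ j _)

δ-above : ∀ {n} (I : Pair (suc n)) j → ¬ inject₁ j Fin.< Pair.max I → δ I (Fin.suc j) ≡ j
δ-above (pair min max _) j ¬j<max with Fin.<-cmp (Fin.suc j) max
... | tri< j<max _ _ = ⊥-elim (¬j<max (subst (_< toℕ max) (sym (Fin.toℕ-inject₁ j))
      (≤-trans (n≤1+n _) j<max)))
... | tri≈ _ refl _  = ⊥-elim (¬j<max (s≤s (≤-reflexive (Fin.toℕ-inject₁ j))))
... | tri> _ _ _     = refl

-- A preimage of `j` is `j` itself below the maximum and `j + 1` from there on. Surjectivity ensures
-- that every variable of the minor is met.
δ-surjective : ∀ {n} (I : Pair (suc n)) j → ∃ λ i → δ I i ≡ j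
δ-surjective I@(pair min max _) j with Fin.<-cmp (inject₁ j) max in eq
... | tri≈ ¬j<max _ _ = Fin.suc j , δ-above I j ¬j<max
... | tri> ¬j<max _ _ = Fin.suc j , δ-above I j ¬j<max
... | tri< _ _ _      = inject₁ j , below
  where
  below : δ I (inject₁ j) ≡ j
  below rewrite eq = lower-inject₁ j _

toList-· : ∀ {m n} (as : Vec A n) (σ : Fin m → Fin n) → toList (as · σ) ≡ map (lookup as) (tabulate σ)
toList-· as σ = trans (toList-tabulate (lookup as ∘ σ)) (sym (map-tabulate σ (lookup as)))
  where
  toList-tabulate : ∀ {m} (f : Fin m → _) → toList (Vec.tabulate f) ≡ tabulate f
  toList-tabulate {zero}  f = refl
  toList-tabulate {suc m} f = cong (f Fin.zero ∷_) (toList-tabulate (f ∘ Fin.suc))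

·-· : ∀ {l m n} (as : Vec A n) (σ : Fin m → Fin n) (τ : Fin l → Fin m) → (as · σ) · τ ≡ as · (σ ∘ τ)
·-· as σ τ = Vec.tabulate-cong (λ i → Vec.lookup∘tabulate (lookup as ∘ σ) (τ i))

unique-permutation : ∀ {xs ys : List A} → Unique xs → Unique ys →
  (∀ {x} → x ∈ xs → x ∈ ys) → (∀ {x} → x ∈ ys → x ∈ xs) → xs ↭ ys
unique-permutation ux uy to from = ∼bag⇒↭ (unique∧set⇒bag ux uy (mk⇔ to from))

unique-length≤ : ∀ {k} → A ↔ Fin k → ∀ {xs : List A} → Unique xs → length xs ≤ k
unique-length≤ {k = k} A↔Fin {xs} uniq with zs , p ← ⊆⇒↭++ {ys = allFin k}
    (Unique-map⁺ (Injection.injective (↔⇒↣ A↔Fin)) uniq) (λ _ → ∈-allFin _) =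
  ≤-trans (≤-reflexive (sym (length-map _ xs))) (≤-trans (m≤m+n _ (length zs))
    (≤-reflexive (trans (sym (length-++ (map _ xs))) (trans (sym (↭-length p)) (length-tabulate id)))))

-- `twisted` has period 4, and `suc r` will be the size `k` of the alphabet.
untwisted : ∀ r → suc r % 4 ≡ 1 ⊎ suc r % 4 ≡ 2 → twisted r ≡ false
untwisted 0 _ = refl
untwisted 1 _ = refl
untwisted 2 (inj₁ ())
untwisted 2 (inj₂ ())
untwisted 3 (inj₁ ())
untwisted 3 (inj₂ ())
untwisted (suc (suc (suc (suc r)))) h = trans (not-involutive (twisted r)) (untwisted r h)

swapLast-replicate : ∀ n (x : A) → swapLast (replicate n x) ≡ replicate n x
swapLast-replicate 0 x = refl
swapLast-replicate 1 x = refl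
swapLast-replicate 2 x = refl
swapLast-replicate (suc (suc (suc n))) x = cong (x ∷_) (swapLast-replicate (suc (suc n)) x)

absorb-replicate : ∀ {H : List A → B} → LeftRegular 0 H → ∀ u x n → x ∈ u → H (u ++ replicate n x) ≡ H u
absorb-replicate {H = H} lr u x zero    x∈ = cong H (++-identityʳ u)
absorb-replicate lr u x (suc n) x∈ = trans (absorb lr u (replicate n x) x∈ z≤n)
    (absorb-replicate lr u x n x∈)


-- The distinct letters of a word are padded with copies of the last one to length
-- suc m.  Padding, if there is any, makes the word invariant under swapLast;
-- otherwise k ≡ 1, 2 (mod 4) decides.
determined : (_≟_ : DecidableEquality A) → ∀ {k m} → A ↔ Fin k → k ≤ suc m →
    (suc m ≤ k → twisted m ≡ false) →
  ∀ {F G : List A → B} → LeftRegular 0 F → LeftRegular 0 G →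
  ∀ (L M : List (Fin (suc (suc m)))) → Unique L → L ↭ M → length L ≡ suc (suc m) →
  (∀ φ → F (map φ L) ≡ G (map φ M)) → ∀ x xs → F (x ∷ xs) ≡ G (x ∷ xs)
determined _≟_ {k} {m} A↔Fin k≤ small {F} {G} lrF lrG L M uniq L↭M lenL h x xs
  with deduplicate _≟_ (x ∷ xs) in d≡ | initLast (deduplicate _≟_ (x ∷ xs))
... | .(d ∷ʳ y) | d ∷ʳ′ y = begin
    F (x ∷ xs) ≡⟨ pad lrF ⟩
    F ω        ≡⟨ word (Peel.equal-or-swapped Fin._≟_ x lrF lrG L M uniq L↭M lenL h ω lenω) ⟩
    G ω        ≡⟨ pad lrG ⟨
    G (x ∷ xs) ∎
  where
  open ≡-Reasoning
  c : ℕ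
  c = suc m ∸ length (d ∷ʳ y)
  ω : List _
  ω = (d ∷ʳ y) ++ replicate c y
  len≤k : length (d ∷ʳ y) ≤ k
  len≤k = unique-length≤ A↔Fin (subst Unique d≡ (deduplicate-! _≟_ (x ∷ xs)))
  lenω : length ω ≡ suc m
  lenω = trans (length-++ (d ∷ʳ y)) (trans (cong (length (d ∷ʳ y) +_) (length-replicate c))
      (m+[n∸m]≡n (≤-trans len≤k k≤)))
  pad : ∀ {H} → LeftRegular 0 H → H (x ∷ xs) ≡ H ω
  pad {H} lr = begin
    H (x ∷ xs)                              ≡⟨ cong H (map-id (x ∷ xs)) ⟨
    H (map id (x ∷ xs))                     ≡⟨ absorb-deduplicate _≟_ lr id [] (x ∷ xs) ⟨
    H (map id (deduplicate _≟_ (x ∷ xs)))   ≡⟨ cong H (trans (map-id _) d≡) ⟩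
    H (d ∷ʳ y)                              ≡⟨ absorb-replicate lr (d ∷ʳ y) y c (∈-++⁺ʳ d (here refl)) ⟨
    H ω                                     ∎
  swapLast-pad : ∀ n → swapLast ((d ∷ʳ y) ++ replicate (suc n) y) ≡ (d ∷ʳ y) ++ replicate (suc n) y
  swapLast-pad n rewrite ++-assoc d [ y ] (replicate (suc n) y) =
    trans (swapLast-++ d y y (replicate n y)) (cong (d ++_) (swapLast-replicate (suc (suc n)) y))
  word : F ω ≡ G ω ⊎ twisted m ≡ true × F ω ≡ G (swapLast ω) → F ω ≡ G ω
  word (inj₁ e)        = e
  word (inj₂ (tw , e)) with c in c≡
  ... | suc n = trans e (cong G (swapLast-pad n))
  ... | zero  with () ← trans (sym tw) (small (≤-trans (m∸n≡0⇒m≤n c≡) len≤k))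

k+2≤n : ∀ {k n} {X Y : Set} → (X × n ≥ k + 2) ⊎ (Y × n ≥ k + 3) → k + 2 ≤ n
k+2≤n     (inj₁ (_ , n≥)) = n≥
k+2≤n {k} (inj₂ (_ , n≥)) = ≤-trans (+-monoʳ-≤ k (s≤s (s≤s z≤n))) n≥

-- Here `n = 3 + m`. The first alternative gives `k ≤ suc m`, hence equality; the second gives
-- `k ≤ m`, a contradiction.
untwisted-bound : ∀ {k m} {Y : Set} → suc m ≤ k →
  ((k % 4 ≡ 1 ⊎ k % 4 ≡ 2) × 3 + m ≥ k + 2) ⊎ (Y × 3 + m ≥ k + 3) → twisted m ≡ false
untwisted-bound {k} {m} m<k (inj₁ (k%4 , n≥)) = untwisted m (subst (λ k → k % 4 ≡ 1 ⊎ k % 4 ≡ 2)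
  (≤-antisym (≤-pred (≤-pred (≤-trans (≤-reflexive (+-comm 2 k)) n≥))) m<k) k%4)
untwisted-bound {k} {m} m<k (inj₂ (_ , n≥)) =
  ⊥-elim (1+n≰n (≤-trans m<k (+-cancelˡ-≤ 3 k m (≤-trans (≤-reflexive (+-comm 3 k)) n≥))))

proposition8p1 : ∀ {a b} {A : Set a} {B : Set b} (n k : ℕ) → .{{_ : NonZero n}} → .{{_ : NonZero k}} →
    ((k % 4 ≡ 1 ⊎ k % 4 ≡ 2) × n ≥ k + 2) ⊎ ((k % 4 ≡ 0 ⊎ k % 4 ≡ 3) × n ≥ k + 3) →
    AtLeastTwo A → AtLeastTwo B →
    (∣A∣≡k : A ↔ Fin k) →
    (f g : Vec A n → B) →
    WeaklyDeterminedByOfo (finite⇒≟ ∣A∣≡k) f →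
    WeaklyDeterminedByOfo (finite⇒≟ ∣A∣≡k) g →
    SameDeck f g →
    f ∼ g
-- As `k` is positive, `k + 2 ≤ n` leaves only `n ≥ 3`.
proposition8p1 zero                k cond _ _ _ with () ← ≤-trans (m≤n+m 2 k) (k+2≤n cond)
proposition8p1 (suc zero)          k cond _ _ _ with s≤s () ← ≤-trans (m≤n+m 2 k) (k+2≤n cond)
proposition8p1 (suc (suc zero)) (suc k) cond _ _ _
  with s≤s (s≤s ()) ← ≤-trans (≤-reflexive (+-comm 2 (suc k))) (k+2≤n {suc k} cond)
proposition8p1 {A = A} {B = B} n@(suc (suc (suc m))) k cond (x₀ , _) (b₀ , _) ∣A∣≡k f g (f* , σ , f-ofo)
    (g* , τ , g-ofo) (Φ , minors∼)
  -- A single matched pair of minors yields `h` below. The witness applies the inverse of `τ` and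
  -- then `σ`, so that reading through `τ` gives back the order `σ`.
  with ρ , f_I≡g_J ← minors∼ (pair Fin.zero (Fin.suc Fin.zero) (s≤s z≤n)) = flip τ ∘ₚ σ , λ as → begin
    f as                                   ≡⟨ f≡ as ⟩
    F (toList (as · (σ ⟨$⟩ʳ_)))             ≡⟨ F≡G (as · (σ ⟨$⟩ʳ_)) ⟩
    G (toList (as · (σ ⟨$⟩ʳ_)))             ≡⟨ cong (G ∘ toList)
        (trans (·-· as (flip τ ∘ₚ σ ⟨$⟩ʳ_) (τ ⟨$⟩ʳ_))
            (Vec.tabulate-cong (λ i → cong (lookup as ∘ (σ ⟨$⟩ʳ_)) (inverseˡ τ {i})))) ⟨
    G (toList (as · (flip τ ∘ₚ σ ⟨$⟩ʳ_) · (τ ⟨$⟩ʳ_))) ≡⟨ g≡ (as · (flip τ ∘ₚ σ ⟨$⟩ʳ_)) ⟨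
    g (as · (flip τ ∘ₚ σ ⟨$⟩ʳ_))            ∎
  where
  open ≡-Reasoning
  _≟_ : DecidableEquality A
  _≟_ = finite⇒≟ ∣A∣≡k
  F G : List A → B
  F = onWords _≟_ b₀ f*
  G = onWords _≟_ b₀ g*
  f≡ : ∀ as → f as ≡ F (toList (as · (σ ⟨$⟩ʳ_)))
  f≡ as = trans (f-ofo as) (sym (onWords-toList _≟_ b₀ f* (as · (σ ⟨$⟩ʳ_))))
  g≡ : ∀ as → g as ≡ G (toList (as · (τ ⟨$⟩ʳ_)))
  g≡ as = trans (g-ofo as) (sym (onWords-toList _≟_ b₀ g* (as · (τ ⟨$⟩ʳ_))))
  I J : Pair n
  I = pair Fin.zero (Fin.suc Fin.zero) (s≤s z≤n)
  J = Inverse.to Φ I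
  ξ η : Fin n → Fin (suc (suc m))
  ξ = δ I ∘ (σ ⟨$⟩ʳ_)
  η = (ρ ⟨$⟩ʳ_) ∘ δ J ∘ (τ ⟨$⟩ʳ_)
  -- These list the variables of the minor in the order in which `F` and `G` first meet them.
  L M : List (Fin (suc (suc m)))
  L = deduplicate Fin._≟_ (tabulate ξ)
  M = deduplicate Fin._≟_ (tabulate η)
  ∈L : ∀ j → j ∈ L
  ∈L j with i , refl ← δ-surjective I j =
    ∈-deduplicate⁺ Fin._≟_ (subst (λ i → δ I i ∈ tabulate ξ) (inverseʳ σ {i})
        (∈-tabulate⁺ {f = ξ} (σ ⟨$⟩ˡ i)))
  ∈M : ∀ j → j ∈ M
  ∈M j with i , δi≡ ← δ-surjective J (ρ ⟨$⟩ˡ j) = ∈-deduplicate⁺ Fin._≟_ (subst (_∈ tabulate η)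
    (trans (cong ((ρ ⟨$⟩ʳ_) ∘ δ J) (inverseʳ τ {i})) (trans (cong (ρ ⟨$⟩ʳ_) δi≡) (inverseʳ ρ)))
        (∈-tabulate⁺ {f = η} (τ ⟨$⟩ˡ i)))
  uniqL : Unique L
  uniqL = deduplicate-! Fin._≟_ (tabulate ξ)
  uniqM : Unique M
  uniqM = deduplicate-! Fin._≟_ (tabulate η)
  h : ∀ (φ : Fin (suc (suc m)) → A) → F (map φ L) ≡ G (map φ M)
  h φ = begin
    F (map φ L)                               ≡⟨ absorb-deduplicate Fin._≟_
        (onWords-leftRegular _≟_ b₀ f*) φ [] (tabulate ξ) ⟩
    F (map φ (tabulate ξ))                    ≡⟨ cong F (word ξ) ⟨
    F (toList (as · ξ))                       ≡⟨ cong (F ∘ toList) (·-· as (δ I) (σ ⟨$⟩ʳ_)) ⟨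
    F (toList (as · δ I · (σ ⟨$⟩ʳ_)))          ≡⟨ f≡ (as · δ I) ⟨
    f (as · δ I)                              ≡⟨ f_I≡g_J as ⟩
    g (as · (ρ ⟨$⟩ʳ_) · δ J)                   ≡⟨ g≡ (as · (ρ ⟨$⟩ʳ_) · δ J) ⟩
    G (toList (as · (ρ ⟨$⟩ʳ_) · δ J · (τ ⟨$⟩ʳ_))) ≡⟨ cong (G ∘ toList)
        (trans (·-· (as · (ρ ⟨$⟩ʳ_)) (δ J) (τ ⟨$⟩ʳ_)) (·-· as (ρ ⟨$⟩ʳ_) (δ J ∘ (τ ⟨$⟩ʳ_)))) ⟩
    G (toList (as · η))                       ≡⟨ cong G (word η) ⟩
    G (map φ (tabulate η))                    ≡⟨ absorb-deduplicate Fin._≟_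
        (onWords-leftRegular _≟_ b₀ g*) φ [] (tabulate η) ⟨
    G (map φ M)                               ∎
    where
    as : Vec A (suc (suc m))
    as = Vec.tabulate φ
    word : (ζ : Fin n → Fin (suc (suc m))) → toList (as · ζ) ≡ map φ (tabulate ζ)
    word ζ = trans (toList-· as ζ) (map-cong (Vec.lookup∘tabulate φ) (tabulate ζ))
  F≡G : ∀ (as : Vec A n) → F (toList as) ≡ G (toList as)
  F≡G (x Vec.∷ as) = determined _≟_ ∣A∣≡k (≤-pred
      (≤-pred (≤-trans (≤-reflexive (+-comm 2 k)) (k+2≤n cond)))) (λ r≤k → untwisted-bound r≤k cond)
          (onWords-leftRegular _≟_ b₀ f*) (onWords-leftRegular _≟_ b₀ g*)
    L M uniqL (unique-permutation uniqL uniqM (λ _ → ∈M _) (λ _ → ∈L _))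
    (trans (↭-length (unique-permutation uniqL (allFin⁺ _) (λ _ → ∈-allFin _) (λ _ → ∈L _)))
        (length-tabulate id))
    h x (toList as)
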